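{- Fix $\eta\in(0,1/3)$ and constants $0<a\le b$. For any $N\ge2$, $T\ge 1$, SLAs $\beta(i)\ge0$ with $\sum_i\beta(i)\le1$, loads $L_1,\dots,L_T\in\mathbb{R}_{\ge0}^N$, and any $\varepsilon$ with $a\frac{N^{1/3}}{T^{1/4}}\le\varepsilon\le b\frac{N^{1/3}}{T^{1/4}}$ and $\varepsilon\le\frac1{10}$, Algorithm 1 (defined in the context) run with parameters $\varepsilon,\eta$ guarantees $$\mathrm{work}_{h_1^*,\dots,h_T^*}-\mathrm{work}_{\mathrm{alg}}\ \le\ \mathcal{O}\!\left(N^{1/3}T^{3/4}+N^{1/3}T^{1/2}\log(NT)\right)=\mathcal{O}\!\left(N^{1/3}T^{3/4}\right),$$ where $h_1^*,\dots,h_T^*$ are optimal offline dynamic allocations, i.e. a sequence maximizing the total work over all sequences $h_1,\dots,h_T\in[0,1]^N$ with $\sum_i h_t(i)\le1$ for every $t$ (loads known in advance), and the implied constants depend only on $\eta,a,b$.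
   Context: Model. There are $N\ge 2$ users sharing one resource of capacity $1$ over discrete times $t=1,\dots,T$. User $i$ has an SLA $\beta(i)\ge 0$. At time $t$ a load $L_t(i)\ge 0$ arrives for user $i$. Given allocations $h_1,\dots,h_T\in[0,1]^N$ with $\sum_i h_t(i)\le 1$, the work and the queues are defined by $Q_1(i)=0$ and $$w_t(i)=\min\{h_t(i),\,L_t(i)+Q_t(i)\},\qquad Q_{t+1}(i)=\max\{0,\,L_t(i)+Q_t(i)-h_t(i)\}.$$ The (total) work of the allocations is $\mathrm{work}_{h_1,\dots,h_T}=\sum_{t=1}^T\sum_{i=1}^N w_t(i)$; $\mathrm{work}_{\mathrm{alg}}$ is the total work of the algorithm's allocations. At time $t$ the only feedback is the set of active users $A_t=\{i: Q_t(i)>0\}$ and inactive users $B_t=\{1,\dots,N\}\setminus A_t$. Truncated simplex and projection. $\Delta_\varepsilon=\{x\in\mathbb{R}^N:\sum_i x(i)=1,\ x(i)\ge\varepsilon/N\ \forall i\}$, and for $y$ with positive entries $\pi_{\Delta_\varepsilon}(y)=\operatorname{argmin}_{x\in\Delta_\varepsilon}\sum_i x(i)\log(x(i)/y(i))$. Algorithm 1 (parameters $\varepsilon,\eta$). Set $\lambda=\frac{\varepsilon^2}{8N}$ and let $h_1$ be any element of $\Delta_\varepsilon$. For $t=1,\dots,T$: use allocation $h_t$; read $A_t,B_t$; let $A_t^1=\{i\in A_t:h_t(i)<\beta(i)\}$ and $A_t^2=A_t\setminus A_t^1$; set $g_t(i)=1+\lambda$ for $i\in A_t^1$, $g_t(i)=1$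 for $i\in A_t^2$, $g_t(i)=0$ for $i\in B_t$; set $\widehat h_{t+1}(i)=h_t(i)e^{\eta g_t(i)}$ and $h_{t+1}=\pi_{\Delta_\varepsilon}(\widehat h_{t+1})$. -}

module Defs where

open import Level using (_⊔_) renaming (suc to ℓsuc)
open import Algebra.Apartness.Bundles using (HeytingField; module HeytingCommutativeRing)
open import Algebra.Bundles using (CommutativeRing)
import Algebra.Definitions.RawMonoid as RawMonoidDefs
import Algebra.Properties.Monoid.Sum as MonoidSum
import Algebra.Properties.Ring as RingProperties
open import Data.Empty using (⊥-elim)
open import Data.Fin.Base using (Fin; toℕ)
open import Data.Nat.Base as ℕ using (ℕ; zero; suc; NonZero)
open import Data.Product.Base using (∃-syntax; _×_; _,_)
open import Data.Sum.Base using (_⊎_; inj₁; inj₂)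
open import Data.Vec.Functional using (Vector)
open import Relation.Binary.Core using (Rel)
open import Relation.Binary.Definitions using (Cotransitive)
open import Relation.Binary.Lattice.Definitions using (Supremum; Infimum)
open import Relation.Binary.Structures using (IsStrictPartialOrder)
open import Relation.Nullary.Negation.Core using (¬_)

-- The real numbers, axiomatised as a Cauchy-complete Archimedean ordered
-- field.  With excluded middle this says "complete ordered field", so ℝ is
-- the only model up to isomorphism.  No decidability of the order is assumed,
-- so constructively built reals are models as well.
record RealNumbers c ℓ₁ ℓ₂ : Set (ℓsuc (c ⊔ ℓ₁ ⊔ ℓ₂)) where
  infix 4 _<_ _≤_
  infixl 6 _∨_
  infixl 7 _∧_
  field
    heytingField : HeytingField c ℓ₁ ℓ₂

  open HeytingField heytingField public
  open HeytingCommutativeRing heytingCommutativeRing public using (commutativeRing)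
  open CommutativeRing commutativeRing public using (+-monoid; +-rawMonoid; ring)
  open RawMonoidDefs +-rawMonoid public using () renaming (_×_ to _·_)

  field
    _<_                  : Rel Carrier ℓ₂
    isStrictPartialOrder : IsStrictPartialOrder _≈_ _<_
    #⇒<⊎>                : ∀ {x y} → x # y → x < y ⊎ y < x
    <⇒#                  : ∀ {x y} → x < y → x # y
    +-monoʳ-<            : ∀ z {x y} → x < y → z + x < z + y
    *-pos                : ∀ {x y} → 0# < x → 0# < y → 0# < x * y

  open IsStrictPartialOrder isStrictPartialOrder public
    using (irrefl; <-respˡ-≈; <-respʳ-≈)
    renaming (trans to <-trans; asym to <-asym)

  _≤_ : Rel Carrier ℓ₂
  x ≤ y = ¬ (y < x)

  field
    _∨_        : Carrier → Carrier → Carrier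
    _∧_        : Carrier → Carrier → Carrier
    ∨-supremum : Supremum _≤_ _∨_
    ∧-infimum  : Infimum _≤_ _∧_

  ∣_∣ : Carrier → Carrier
  ∣ x ∣ = x ∨ (- x)

  natural : ℕ → Carrier
  natural n = n · 1#

  IsCauchy : (ℕ → Carrier) → Set (c ⊔ ℓ₂)
  IsCauchy u = ∀ δ → 0# < δ →
    ∃[ M ] (∀ m n → M ℕ.≤ m → M ℕ.≤ n → ∣ u m - u n ∣ < δ)

  _ConvergesTo_ : (ℕ → Carrier) → Carrier → Set (c ⊔ ℓ₂)
  u ConvergesTo l = ∀ δ → 0# < δ →
    ∃[ M ] (∀ n → M ℕ.≤ n → ∣ u n - l ∣ < δ)

  field
    archimedean : ∀ x → ∃[ n ] (x < natural n)
    complete    : ∀ u → IsCauchy u → ∃[ l ] (u ConvergesTo l)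

module PositiveReals {c ℓ₁ ℓ₂} (ℛ : RealNumbers c ℓ₁ ℓ₂) where
  open RealNumbers ℛ
  open RingProperties ring using (-‿distribʳ-*; -0#≈0#; -‿involutive)

  infixl 7 _*⁺_ _/_ _/⁺_

  record ℝ⁺ : Set (c ⊔ ℓ₂) where
    constructor _,⁺_
    infix 9 ↑_
    field
      ↑_       : Carrier
      positive : 0# < ↑_

  open ℝ⁺ public

  <-cotrans : Cotransitive _<_
  <-cotrans x<y z with #-cotrans (<⇒# x<y) z
  ... | inj₁ x#z with #⇒<⊎> x#z
  ...   | inj₁ x<z = inj₁ x<z
  ...   | inj₂ z<x = inj₂ (<-trans z<x x<y)
  <-cotrans x<y z | inj₂ z#y with #⇒<⊎> z#y
  ...   | inj₁ z<y = inj₂ z<y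
  ...   | inj₂ y<z = inj₁ (<-trans x<y y<z)

  <-≤-trans : ∀ {x y z} → x < y → y ≤ z → x < z
  <-≤-trans {z = z} x<y y≤z with <-cotrans x<y z
  ... | inj₁ x<z = x<z
  ... | inj₂ z<y = ⊥-elim (y≤z z<y)

  x-0≈x : ∀ x → x - 0# ≈ x
  x-0≈x x = trans (+-cong refl -0#≈0#) (+-identityʳ x)

  neg-pos : ∀ {x} → x < 0# → 0# < - x
  neg-pos {x} x<0 =
    <-respˡ-≈ (-‿inverseˡ x) (<-respʳ-≈ (+-identityʳ (- x)) (+-monoʳ-< (- x) x<0))

  0<1 : 0# < 1#
  0<1 with #⇒<⊎> (invertible⇒# {1#} {0#} (1# , 1*[1-0] , [1-0]*1))
    where
    1*[1-0] : 1# * (1# - 0#) ≈ 1#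
    1*[1-0] = trans (*-identityˡ _) (x-0≈x 1#)
    [1-0]*1 : (1# - 0#) * 1# ≈ 1#
    [1-0]*1 = trans (*-identityʳ _) (x-0≈x 1#)
  ... | inj₂ 0<1 = 0<1
  ... | inj₁ 1<0 = <-respʳ-≈ -1*-1≈1 (*-pos (neg-pos 1<0) (neg-pos 1<0))
    where
    -1*-1≈1 : - 1# * - 1# ≈ 1#
    -1*-1≈1 = trans (sym (-‿distribʳ-* (- 1#) 1#))
                    (trans (-‿cong (*-identityʳ (- 1#))) (-‿involutive 1#))

  natural-pos : ∀ n → 0# < natural (suc n)
  natural-pos zero    = <-respʳ-≈ (sym (+-identityʳ 1#)) 0<1
  natural-pos (suc n) =
    <-trans 0<1 (<-respˡ-≈ (+-identityʳ 1#) (+-monoʳ-< 1# (natural-pos n)))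

  fromℕ : ∀ n .{{_ : NonZero n}} → ℝ⁺
  fromℕ (suc n) = natural (suc n) ,⁺ natural-pos n

  1/_ : ℝ⁺ → Carrier
  1/ y with #⇒invertible (#-sym (<⇒# (positive y)))
  ... | y⁻¹ , _ = y⁻¹

  *-inverseʳ : ∀ y → ↑ y * 1/ y ≈ 1#
  *-inverseʳ y with #⇒invertible (#-sym (<⇒# (positive y)))
  ... | _ , _ , inv = trans (*-congʳ (sym (x-0≈x (↑ y)))) inv

  1/-pos : ∀ y → 0# < 1/ y
  1/-pos y with #⇒<⊎> (invertible⇒# {1/ y} {0#} (↑ y , left , right))
    where
    left : ↑ y * (1/ y - 0#) ≈ 1#
    left = trans (*-congˡ (x-0≈x (1/ y))) (*-inverseʳ y)
    right : (1/ y - 0#) * ↑ y ≈ 1#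
    right = trans (*-comm _ _) left
  ... | inj₂ 0<1/y = 0<1/y
  ... | inj₁ 1/y<0 = ⊥-elim (<-asym 0<-1 (neg-pos′ 0<1))
    where
    0<-1 : 0# < - 1#
    0<-1 = <-respʳ-≈
      (trans (sym (-‿distribʳ-* (↑ y) (1/ y))) (-‿cong (*-inverseʳ y)))
      (*-pos (positive y) (neg-pos 1/y<0))
    neg-pos′ : ∀ {x} → 0# < x → - x < 0#
    neg-pos′ {x} 0<x =
      <-respˡ-≈ (+-identityʳ (- x)) (<-respʳ-≈ (-‿inverseˡ x) (+-monoʳ-< (- x) 0<x))

  _/_ : Carrier → ℝ⁺ → Carrier
  x / y = x * 1/ y

  _*⁺_ : ℝ⁺ → ℝ⁺ → ℝ⁺
  x *⁺ y = (↑ x * ↑ y) ,⁺ *-pos (positive x) (positive y)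

  _/⁺_ : ℝ⁺ → ℝ⁺ → ℝ⁺
  x /⁺ y = (↑ x / y) ,⁺ *-pos (positive x) (1/-pos y)

-- The exponential function and the natural logarithm.  The functional
-- equation together with 1 + x ≤ exp x determines exp: they force
-- (1 + x/n)ⁿ ≤ exp x ≤ (1 - x/n)⁻ⁿ for all large n.
record ExpLog {c ℓ₁ ℓ₂} (ℛ : RealNumbers c ℓ₁ ℓ₂) : Set (c ⊔ ℓ₁ ⊔ ℓ₂) where
  open RealNumbers ℛ
  open PositiveReals ℛ

  infixr 8 _^_
  field
    exp      : Carrier → ℝ⁺
    exp-cong : ∀ {x y} → x ≈ y → ↑ exp x ≈ ↑ exp y
    exp-+    : ∀ x y → ↑ exp (x + y) ≈ ↑ exp x * ↑ exp y
    1+x≤exp  : ∀ x → 1# + x ≤ ↑ exp x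
    log      : ℝ⁺ → Carrier
    exp-log  : ∀ y → ↑ exp (log y) ≈ ↑ y

  _^_ : ℝ⁺ → Carrier → ℝ⁺
  x ^ p = exp (p * log x)

module ResourceSharing {c ℓ₁ ℓ₂} (ℛ : RealNumbers c ℓ₁ ℓ₂) (ℰ : ExpLog ℛ) where
  open RealNumbers ℛ
  open PositiveReals ℛ
  open ExpLog ℰ
  open MonoidSum +-monoid public using (sum; sum-syntax)

  -- Loads and allocations over time.  Times are 0-based: index t is time
  -- t + 1 of the model, and only the entries with t < T are ever relevant.
  Schedule : ℕ → Set c
  Schedule N = ℕ → Vector Carrier N

  queue : ∀ {N} → Schedule N → Schedule N → Schedule N
  queue L h zero    i = 0#
  queue L h (suc t) i = 0# ∨ (L t i + queue L h t i - h t i)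

  workAt : ∀ {N} → Schedule N → Schedule N → Schedule N
  workAt L h t i = h t i ∧ (L t i + queue L h t i)

  totalWork : ∀ {N} → ℕ → Schedule N → Schedule N → Carrier
  totalWork {N} T L h = ∑[ t < T ] ∑[ i < N ] workAt L h (toℕ t) i

  record Feasible {N} (T : ℕ) (h : Schedule N) : Set (c ⊔ ℓ₂) where
    field
      nonneg   : ∀ t → t ℕ.< T → ∀ i → 0# ≤ h t i
      atMost1  : ∀ t → t ℕ.< T → ∀ i → h t i ≤ 1#
      capacity : ∀ t → t ℕ.< T → ∑[ i < N ] h t i ≤ 1#

  record Optimal {N} (T : ℕ) (L h* : Schedule N) : Set (c ⊔ ℓ₂) where
    field
      feasible : Feasible T h*
      maximal  : ∀ h → Feasible T h → totalWork T L h ≤ totalWork T L h*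

  record Δ (ε : ℝ⁺) (N : ℕ) .{{_ : NonZero N}} : Set (c ⊔ ℓ₁ ⊔ ℓ₂) where
    field
      coord : Vector Carrier N
      sum≈1 : ∑[ i < N ] coord i ≈ 1#
      lower : ∀ i → ↑ ε / fromℕ N ≤ coord i

  open Δ public

  coord⁺ : ∀ {ε N} .{{_ : NonZero N}} → Δ ε N → Vector ℝ⁺ N
  coord⁺ {ε} {N} x i =
    coord x i ,⁺ <-≤-trans (positive (ε /⁺ fromℕ N)) (lower x i)

  relativeEntropy : ∀ {N} → Vector ℝ⁺ N → Vector ℝ⁺ N → Carrier
  relativeEntropy {N} x y = ∑[ i < N ] (↑ x i * log (x i /⁺ y i))

  IsProjection : ∀ {ε N} .{{_ : NonZero N}} → Vector ℝ⁺ N → Δ ε N → Set (c ⊔ ℓ₁ ⊔ ℓ₂)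
  IsProjection {ε} {N} y p =
    ∀ (x : Δ ε N) → relativeEntropy (coord⁺ p) y ≤ relativeEntropy (coord⁺ x) y

  A B : ∀ {N} → Vector Carrier N → Fin N → Set ℓ₂
  A Q i = 0# < Q i
  B Q i = ¬ A Q i

  A¹ A² : ∀ {N} → (β Q h : Vector Carrier N) → Fin N → Set ℓ₂
  A¹ β Q h i = A Q i × h i < β i
  A² β Q h i = A Q i × ¬ A¹ β Q h i

  -- A relation, because membership in A and A¹ is not assumed decidable.
  record IsGain {N} (ƛ : Carrier) (β Q h g : Vector Carrier N)
                : Set (ℓ₁ ⊔ ℓ₂) where
    field
      gain-A¹ : ∀ i → A¹ β Q h i → g i ≈ 1# + ƛ
      gain-A² : ∀ i → A² β Q h i → g i ≈ 1#
      gain-B  : ∀ i → B Q i → g i ≈ 0#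

  allocation : ∀ {ε N} .{{_ : NonZero N}} → (ℕ → Δ ε N) → Schedule N
  allocation h t = coord (h t)

  bonus : ℝ⁺ → ∀ N .{{_ : NonZero N}} → Carrier
  bonus ε N = (↑ ε * ↑ ε) / (fromℕ 8 *⁺ fromℕ N)

  -- The runs of the algorithm.  The initial point h 0 is arbitrary.
  record Run {N} .{{_ : NonZero N}} (T : ℕ) (ε : ℝ⁺) (η : Carrier)
             (β : Vector Carrier N) (L : Schedule N) (h : ℕ → Δ ε N)
             : Set (c ⊔ ℓ₁ ⊔ ℓ₂) where
    field
      g      : Schedule N
      gain   : ∀ t → t ℕ.< T →
               IsGain (bonus ε N) β (queue L (allocation h) t)
                      (allocation h t) (g t)
      update : ∀ t → t ℕ.< T →
               IsProjection (λ i → coord⁺ (h t) i *⁺ exp (η * g t i)) (h (suc t))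

module Submission where

-- Let E(t) be the work of h* minus the work of the algorithm before time t.
-- Since both face the same loads, E(t) is at most the total queue of the
-- algorithm, and it grows in one step by at most the capacity that the
-- algorithm wastes.  Wasted capacity sits on queues just emptied, hence on
-- inactive users.  Over any period in which user j stays active, the mirror
-- ascent inequality with a comparator close to the vertex j bounds the total
-- mass on inactive users by log (N/ε) plus O(ε) per step, up to a factor that
-- depends on η.  Start counting at the last time at which the total queue is
-- at most N M + 1.  From then on some queue always exceeds M, and it stays
-- nonempty for M steps, so the comparator has to change only every M steps;
-- M ≈ T^¾ / N^⅔ gives the rate.

open import Defs
open import Algebra.Bundles using (CommutativeRing)
import Algebra.Properties.Monoid.Mult as MonoidMult
import Algebra.Properties.Ring as RingProperties
import Algebra.Properties.Semiring.Mult.TCOptimised as SemiringMult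
import Algebra.Properties.Semiring.Sum as SemiringSum
import Algebra.Solver.Ring as RingSolver
open import Algebra.Solver.Ring.AlmostCommutativeRing
  using (fromCommutativeRing; _-Raw-AlmostCommutative⟶_)
open import Data.Empty using (⊥-elim)
open import Data.Fin.Base using (Fin; zero; suc; toℕ)
open import Data.Integer.Base as ℤ using (ℤ; +_; -[1+_])
import Data.Integer.Properties as ℤ
open import Data.Maybe.Base using (Maybe; just; nothing)
open import Data.Nat.Base as ℕ using (ℕ; zero; suc; NonZero)
import Data.Nat.Properties as ℕ
open import Data.Product.Base using (∃-syntax; _×_; _,_; proj₁; proj₂)
import Data.Sign.Base as Sign
open import Data.Sum.Base as Sum using (_⊎_; inj₁; inj₂)
open import Data.Vec.Functional using (Vector)
open import Level using (Level)
open import Relation.Binary.PropositionalEquality.Core as ≡ using (_≡_)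
import Relation.Binary.Reasoning.Base.Triple as Triple
open import Relation.Binary.Structures using (IsPreorder)
open import Relation.Nullary.Decidable.Core using (yes; no)
open import Relation.Nullary.Negation.Core using (¬_)

-- The waste of a round falls on users who are inactive in the next round, and mirror ascent weighs
-- them there by their new shares. The projection may lower a share, so it has to be shown that a
-- share drops by at most the constant factor `exp (η + η)` per round. Gains are measured against
-- the largest possible gain `G`. A user with share `h` and gain `g` then contributes the
-- nonnegative amount `h * (1 - exp (η * (g - G)))`, which for an inactive user is at least
-- `1 - exp (- η)` times the share. Keeping this expression exact leaves no error term of second
-- order in `η`, so a constant `η` works and no step size has to tend to zero. For the rate put ν =
-- N^⅓ and τ = T^¼. The comparators lose about T ε ≈ ν τ³, the initial queue is N M ≈ ν τ³, and the
-- changes of comparator cost about T Λ / M ≈ ν² τ Λ with Λ = log (N/ε). The last cost has the right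
-- order because Λ = O(τ) and because the lower bound on ε together with ε ≤ 1 forces ν = O(τ).

-- A ring solver with integer coefficients

module IntegerSolver {c ℓ : Level} (R : CommutativeRing c ℓ) where
  open CommutativeRing R
  open RingProperties ring
  open SemiringMult semiring using (×-homo-+; ×1-homo-*) renaming (_×_ to infixl 8 _·_)
  open import Relation.Binary.Reasoning.Setoid setoid

  fromℤ : ℤ → Carrier
  fromℤ (+ n)    = n · 1#
  fromℤ -[1+ n ] = - (suc n · 1#)

  private
    1+×1 : ∀ n → suc n · 1# ≈ 1# + n · 1#
    1+×1 = ×-homo-+ 1# 1

    cancel : ∀ x y z → x + y - (x + z) ≈ y - z
    cancel x y z = begin
      x + y - (x + z)     ≈⟨ +-cong (+-comm x y) (sym (-‿+-comm x z)) ⟩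
      y + x + (- x - z)   ≈⟨ +-assoc y x (- x - z) ⟩
      y + (x + (- x - z)) ≈⟨ +-congˡ (+-assoc x (- x) (- z)) ⟨
      y + (x - x - z)     ≈⟨ +-congˡ (trans (+-congʳ (-‿inverseʳ x)) (+-identityˡ (- z))) ⟩
      y - z               ∎

  fromℤ-⊖ : ∀ m n → fromℤ (m ℤ.⊖ n) ≈ m · 1# - n · 1#
  fromℤ-⊖ m       zero    = sym (trans (+-congˡ -0#≈0#) (+-identityʳ _))
  fromℤ-⊖ zero    (suc n) = sym (+-identityˡ _)
  fromℤ-⊖ (suc m) (suc n) = begin
    fromℤ (suc m ℤ.⊖ suc n)         ≡⟨ ≡.cong fromℤ (ℤ.[1+m]⊖[1+n]≡m⊖n m n) ⟩
    fromℤ (m ℤ.⊖ n)                 ≈⟨ fromℤ-⊖ m n ⟩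
    m · 1# - n · 1#                 ≈⟨ cancel 1# _ _ ⟨
    1# + m · 1# - (1# + n · 1#)     ≈⟨ +-cong (1+×1 m) (-‿cong (1+×1 n)) ⟨
    suc m · 1# - suc n · 1#         ∎

  fromℤ-+ : ∀ i j → fromℤ (i ℤ.+ j) ≈ fromℤ i + fromℤ j
  fromℤ-+ (+ m)    (+ n)    = ×-homo-+ 1# m n
  fromℤ-+ (+ m)    -[1+ n ] = fromℤ-⊖ m (suc n)
  fromℤ-+ -[1+ m ] (+ n)    = trans (fromℤ-⊖ n (suc m)) (+-comm _ _)
  fromℤ-+ -[1+ m ] -[1+ n ] = begin
    - (suc (suc (m ℕ.+ n)) · 1#)      ≡⟨ ≡.cong (λ k → - (suc k · 1#)) (ℕ.+-suc m n) ⟨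
    - ((suc m ℕ.+ suc n) · 1#)        ≈⟨ -‿cong (×-homo-+ 1# (suc m) (suc n)) ⟩
    - (suc m · 1# + suc n · 1#)       ≈⟨ -‿+-comm _ _ ⟨
    - (suc m · 1#) - suc n · 1#       ∎

  fromℤ-neg : ∀ i → fromℤ (ℤ.- i) ≈ - fromℤ i
  fromℤ-neg (+ zero)  = sym -0#≈0#
  fromℤ-neg (+ suc n) = refl
  fromℤ-neg -[1+ n ]  = sym (-‿involutive _)

  private
    neg-◃ : ∀ n → fromℤ (Sign.- ℤ.◃ n) ≈ - (n · 1#)
    neg-◃ zero    = sym -0#≈0#
    neg-◃ (suc n) = refl

    pos-◃ : ∀ n → fromℤ (Sign.+ ℤ.◃ n) ≈ n · 1#
    pos-◃ zero    = refl
    pos-◃ (suc n) = refl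

  fromℤ-* : ∀ i j → fromℤ (i ℤ.* j) ≈ fromℤ i * fromℤ j
  fromℤ-* (+ m)    (+ n)    = trans (pos-◃ (m ℕ.* n)) (×1-homo-* m n)
  fromℤ-* (+ m)    -[1+ n ] = begin
    fromℤ (Sign.- ℤ.◃ (m ℕ.* suc n)) ≈⟨ neg-◃ (m ℕ.* suc n) ⟩
    - ((m ℕ.* suc n) · 1#)           ≈⟨ -‿cong (×1-homo-* m (suc n)) ⟩
    - (m · 1# * (suc n · 1#))        ≈⟨ -‿distribʳ-* _ _ ⟩
    m · 1# * - (suc n · 1#)          ∎
  fromℤ-* -[1+ m ] (+ n)    = begin
    fromℤ (Sign.- ℤ.◃ (suc m ℕ.* n)) ≈⟨ neg-◃ (suc m ℕ.* n) ⟩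
    - ((suc m ℕ.* n) · 1#)           ≈⟨ -‿cong (×1-homo-* (suc m) n) ⟩
    - (suc m · 1# * (n · 1#))        ≈⟨ -‿distribˡ-* _ _ ⟩
    - (suc m · 1#) * (n · 1#)        ∎
  fromℤ-* -[1+ m ] -[1+ n ] = begin
    (suc m ℕ.* suc n) · 1#             ≈⟨ ×1-homo-* (suc m) (suc n) ⟩
    suc m · 1# * (suc n · 1#)          ≈⟨ -‿involutive _ ⟨
    - - (suc m · 1# * (suc n · 1#))    ≈⟨ -‿cong (-‿distribˡ-* _ _) ⟩
    - (- (suc m · 1#) * (suc n · 1#))  ≈⟨ -‿distribʳ-* _ _ ⟩
    - (suc m · 1#) * - (suc n · 1#)    ∎

  fromℤ-homomorphism : ℤ.+-*-rawRing -Raw-AlmostCommutative⟶ fromCommutativeRing R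
  fromℤ-homomorphism = record
    { ⟦_⟧    = fromℤ
    ; +-homo = fromℤ-+
    ; *-homo = fromℤ-*
    ; -‿homo = fromℤ-neg
    ; 0-homo = refl
    -- The optimised multiple has no trailing `0#`, so `1 · 1#` reduces to `1#`.
    ; 1-homo = refl
    }

  -- Equality of reals is not decidable, so coefficients are compared as integers; answering
  -- `nothing` is always sound.
  fromℤ≟ : ∀ i j → Maybe (fromℤ i ≈ fromℤ j)
  fromℤ≟ i j with i ℤ.≟ j
  ... | yes i≡j = just (reflexive (≡.cong fromℤ i≡j))
  ... | no  _   = nothing

  open RingSolver ℤ.+-*-rawRing (fromCommutativeRing R) fromℤ-homomorphism fromℤ≟ public
    using (Polynomial; con; _:+_; _:*_; _:-_; :-_; _:=_; solve)

  one nil : ∀ {n} → Polynomial n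
  one = con (+ 1)
  nil = con (+ 0)

-- Since `x ≤ y` is the negation of `y < x`, every inequality `≤` may be proved by a case split on
-- an undecidable proposition. This takes the place of excluded middle throughout.
by-cases : ∀ {p q} (P : Set p) {Q : Set q} → (P → ¬ Q) → (¬ P → ¬ Q) → ¬ Q
by-cases P yes-case no-case q = no-case (λ p → yes-case p q) q

-- Order and arithmetic of the reals

module OrderProperties {c ℓ₁ ℓ₂} (ℛ : RealNumbers c ℓ₁ ℓ₂) where
  open RealNumbers ℛ hiding (zero)
  open PositiveReals ℛ
  open IntegerSolver commutativeRing
  open MonoidMult +-monoid using (×-homo-+)

  <⇒≤ : ∀ {x y} → x < y → x ≤ y
  <⇒≤ = <-asym

  ≤-reflexive : ∀ {x y} → x ≈ y → x ≤ y
  ≤-reflexive x≈y y<x = irrefl (sym x≈y) y<x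

  ≤-refl : ∀ {x} → x ≤ x
  ≤-refl = ≤-reflexive refl

  ≤-trans : ∀ {x y z} → x ≤ y → y ≤ z → x ≤ z
  ≤-trans {y = y} x≤y y≤z z<x with <-cotrans z<x y
  ... | inj₁ z<y = y≤z z<y
  ... | inj₂ y<x = x≤y y<x

  ≤-<-trans : ∀ {x y z} → x ≤ y → y < z → x < z
  ≤-<-trans {x = x} x≤y y<z with <-cotrans y<z x
  ... | inj₁ y<x = ⊥-elim (x≤y y<x)
  ... | inj₂ x<z = x<z

  ≤-antisym : ∀ {x y} → x ≤ y → y ≤ x → x ≈ y
  ≤-antisym {x} {y} x≤y y≤x = proj₁ (tight x y) ¬x#y
    where
    ¬x#y : ¬ (x # y)
    ¬x#y x#y with #⇒<⊎> x#y
    ... | inj₁ x<y = y≤x x<y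
    ... | inj₂ y<x = x≤y y<x

  ≤-isPreorder : IsPreorder _≈_ _≤_
  ≤-isPreorder = record
    { isEquivalence = isEquivalence
    ; reflexive     = ≤-reflexive
    ; trans         = ≤-trans
    }

  module ≤-Reasoning = Triple ≤-isPreorder <-asym <-trans (<-respʳ-≈ , <-respˡ-≈) <⇒≤ <-≤-trans ≤-<-trans

  +-monoʳ-≤ : ∀ z {x y} → x ≤ y → z + x ≤ z + y
  +-monoʳ-≤ z {x} {y} x≤y z+y<z+x = x≤y
    (<-respˡ-≈ (cancel y) (<-respʳ-≈ (cancel x) (+-monoʳ-< (- z) z+y<z+x)))
    where
    cancel : ∀ w → - z + (z + w) ≈ w
    cancel = solve 2 (λ z w → :- z :+ (z :+ w) := w) refl z

  +-mono-≤ : ∀ {w x y z} → w ≤ x → y ≤ z → w + y ≤ x + z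
  +-mono-≤ {w} {x} {y} {z} w≤x y≤z = begin
    w + y  ≤⟨ +-monoʳ-≤ w y≤z ⟩
    w + z  ≈⟨ +-comm w z ⟩
    z + w  ≤⟨ +-monoʳ-≤ z w≤x ⟩
    z + x  ≈⟨ +-comm z x ⟩
    x + z  ∎
    where open ≤-Reasoning

  0≤+ : ∀ {x y} → 0# ≤ x → 0# ≤ y → 0# ≤ x + y
  0≤+ 0≤x 0≤y = ≤-trans (≤-reflexive (sym (+-identityˡ 0#))) (+-mono-≤ 0≤x 0≤y)

  ≤-intro : ∀ {x y d} → 0# ≤ d → y ≈ x + d → x ≤ y
  ≤-intro {x} {y} {d} 0≤d y≈x+d = begin
    x       ≈⟨ +-identityʳ x ⟨
    x + 0#  ≤⟨ +-monoʳ-≤ x 0≤d ⟩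
    x + d   ≈⟨ y≈x+d ⟨
    y       ∎
    where open ≤-Reasoning

  ≤⇒0≤- : ∀ {x y} → x ≤ y → 0# ≤ y - x
  ≤⇒0≤- {x} {y} x≤y = begin
    0#       ≈⟨ -‿inverseˡ x ⟨
    - x + x  ≤⟨ +-monoʳ-≤ (- x) x≤y ⟩
    - x + y  ≈⟨ +-comm (- x) y ⟩
    y - x    ∎
    where open ≤-Reasoning

  0≤-⇒≤ : ∀ {x y} → 0# ≤ y - x → x ≤ y
  0≤-⇒≤ {x} {y} 0≤y-x = ≤-intro 0≤y-x (solve 2 (λ x y → y := x :+ (y :- x)) refl x y)

  <⇒0<- : ∀ {x y} → x < y → 0# < y - x
  <⇒0<- {x} {y} x<y = <-respˡ-≈ (-‿inverseˡ x) (<-respʳ-≈ (+-comm (- x) y) (+-monoʳ-< (- x) x<y))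

  0<-⇒< : ∀ {x y} → 0# < y - x → x < y
  0<-⇒< {x} {y} 0<y-x = <-respˡ-≈ (+-identityʳ x)
    (<-respʳ-≈ (solve 2 (λ x y → x :+ (y :- x) := y) refl x y) (+-monoʳ-< x 0<y-x))

  0≤* : ∀ {x y} → 0# ≤ x → 0# ≤ y → 0# ≤ x * y
  0≤* {x} {y} 0≤x 0≤y = by-cases (0# < x)
    (λ 0<x → by-cases (0# < y)
      (λ 0<y → <⇒≤ (*-pos 0<x 0<y))
      (λ y≤0 → ≤-reflexive (sym (trans (*-congˡ (≤-antisym y≤0 0≤y)) (zeroʳ x)))))
    (λ x≤0 → ≤-reflexive (sym (trans (*-congʳ (≤-antisym x≤0 0≤x)) (zeroˡ y))))

  *-monoˡ-≤ : ∀ {x y z} → 0# ≤ z → x ≤ y → z * x ≤ z * y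
  *-monoˡ-≤ {x} {y} {z} 0≤z x≤y = ≤-intro (0≤* 0≤z (≤⇒0≤- x≤y))
    (solve 3 (λ x y z → z :* y := z :* x :+ z :* (y :- x)) refl x y z)

  *-mono-≤ : ∀ {w x y z} → 0# ≤ w → 0# ≤ z → w ≤ x → y ≤ z → w * y ≤ x * z
  *-mono-≤ {w} {x} {y} {z} 0≤w 0≤z w≤x y≤z = begin
    w * y  ≤⟨ *-monoˡ-≤ 0≤w y≤z ⟩
    w * z  ≈⟨ *-comm w z ⟩
    z * w  ≤⟨ *-monoˡ-≤ 0≤z w≤x ⟩
    z * x  ≈⟨ *-comm z x ⟩
    x * z  ∎
    where open ≤-Reasoning

  *-monoʳ-≤ : ∀ {x y z} → 0# ≤ z → x ≤ y → x * z ≤ y * z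
  *-monoʳ-≤ {x} {y} {z} 0≤z x≤y = begin
    x * z  ≈⟨ *-comm x z ⟩
    z * x  ≤⟨ *-monoˡ-≤ 0≤z x≤y ⟩
    z * y  ≈⟨ *-comm z y ⟩
    y * z  ∎
    where open ≤-Reasoning

  0≤1 : 0# ≤ 1#
  0≤1 = <⇒≤ 0<1

  *-cancelˡ-≤ : ∀ {x y z} → 0# < z → z * x ≤ z * y → x ≤ y
  *-cancelˡ-≤ {x} {y} {z} 0<z zx≤zy y<x = zx≤zy (0<-⇒< (<-respʳ-≈
    (solve 3 (λ x y z → z :* (x :- y) := z :* x :- z :* y) refl x y z)
    (*-pos 0<z (<⇒0<- y<x))))

  0≤natural : ∀ n → 0# ≤ natural n
  0≤natural zero    = ≤-refl
  0≤natural (suc n) = <⇒≤ (natural-pos n)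

  natural-mono-≤ : ∀ {m n} → m ℕ.≤ n → natural m ≤ natural n
  natural-mono-≤ {n = n} ℕ.z≤n = 0≤natural n
  natural-mono-≤ (ℕ.s≤s m≤n)   = +-monoʳ-≤ 1# (natural-mono-≤ m≤n)

  natural-+ : ∀ m n → natural (m ℕ.+ n) ≈ natural m + natural n
  natural-+ = ×-homo-+ 1#

  ↑fromℕ : ∀ n .{{_ : NonZero n}} → ↑ fromℕ n ≡ natural n
  ↑fromℕ (suc n) = ≡.refl

  1≤natural : ∀ n .{{_ : NonZero n}} → 1# ≤ natural n
  1≤natural (suc n) = ≤-intro (0≤natural n) refl

  0≤↑ : ∀ y → 0# ≤ ↑ y
  0≤↑ y = <⇒≤ (positive y)

  0≤1/ : ∀ y → 0# ≤ 1/ y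
  0≤1/ y = <⇒≤ (1/-pos y)

  /-* : ∀ x y → (x / y) * ↑ y ≈ x
  /-* x y = begin-equality
    x * 1/ y * ↑ y    ≈⟨ solve 3 (λ x r y → x :* r :* y := x :* (y :* r)) refl x (1/ y) (↑ y) ⟩
    x * (↑ y * 1/ y)  ≈⟨ *-congˡ (*-inverseʳ y) ⟩
    x * 1#            ≈⟨ *-identityʳ x ⟩
    x                 ∎
    where open ≤-Reasoning

  *-/ : ∀ x y → (x * ↑ y) / y ≈ x
  *-/ x y = trans (solve 3 (λ x r y → x :* y :* r := x :* r :* y) refl x (1/ y) (↑ y)) (/-* x y)

  /≤⇒≤* : ∀ {x y z} → x / y ≤ z → x ≤ z * ↑ y
  /≤⇒≤* {x} {y} x/y≤z = ≤-trans (≤-reflexive (sym (/-* x y))) (*-monoʳ-≤ (0≤↑ y) x/y≤z)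

  ≤/⇒*≤ : ∀ {x y z} → z ≤ x / y → z * ↑ y ≤ x
  ≤/⇒*≤ {x} {y} z≤x/y = ≤-trans (*-monoʳ-≤ (0≤↑ y) z≤x/y) (≤-reflexive (/-* x y))

  ≤*⇒/≤ : ∀ {x y z} → x ≤ z * ↑ y → x / y ≤ z
  ≤*⇒/≤ {x} {y} {z} x≤zy = ≤-trans (*-monoʳ-≤ (0≤1/ y) x≤zy) (≤-reflexive (*-/ z y))

  -- Takes the place of the limit θ → 0 in first-order conditions. If `x` were positive, θ = x / (1
  -- + x + k) would lie in (0, 1) and satisfy θ k < x.
  ≤-by-scaling : ∀ {x k} → 0# ≤ k → (∀ θ → 0# < θ → θ < 1# → x ≤ θ * k) → x ≤ 0#
  ≤-by-scaling {x} {k} 0≤k x≤θk 0<x = x≤θk (x / d) (*-pos 0<x (1/-pos d)) θ<1 θk<x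
    where
    d : ℝ⁺
    d = (1# + (x + k)) ,⁺ <-≤-trans 0<1 (≤-intro (0≤+ (<⇒≤ 0<x) 0≤k) refl)
    1+-pos : ∀ {y} → 0# ≤ y → 0# < 1# + y
    1+-pos 0≤y = <-≤-trans 0<1 (≤-intro 0≤y refl)
    θ<1 : x / d < 1#
    θ<1 = 0<-⇒< (<-respʳ-≈
      (trans (solve 3 (λ x k r → (one :+ k) :* r := (one :+ (x :+ k)) :* r :- x :* r) refl x k (1/ d))
        (+-congʳ (*-inverseʳ d)))
      (*-pos (1+-pos 0≤k) (1/-pos d)))
    θk<x : x / d * k < x
    θk<x = 0<-⇒< (<-respʳ-≈
      (trans (solve 3 (λ x k r → x :* ((one :+ x) :* r) := x :* ((one :+ (x :+ k)) :* r) :- x :* r :* k)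
           refl x k (1/ d))
        (+-congʳ (trans (*-congˡ (*-inverseʳ d)) (*-identityʳ x))))
      (*-pos 0<x (*-pos (1+-pos (<⇒≤ 0<x)) (1/-pos d))))

  -- Finite sums

  open CommutativeRing commutativeRing using (semiring)
  open SemiringSum semiring public
    using (sum; sum-syntax; sum-cong-≋; sum-replicate-zero; ∑-distrib-+; *-distribˡ-sum)

  ∑-mono-≤ : ∀ {n} {f g : Vector Carrier n} → (∀ i → f i ≤ g i) → sum f ≤ sum g
  ∑-mono-≤ {zero}  f≤g = ≤-refl
  ∑-mono-≤ {suc n} f≤g = +-mono-≤ (f≤g zero) (∑-mono-≤ (λ i → f≤g (suc i)))

  0≤∑ : ∀ {n} {f : Vector Carrier n} → (∀ i → 0# ≤ f i) → 0# ≤ sum f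
  0≤∑ {zero}  0≤f = ≤-refl
  0≤∑ {suc n} 0≤f = 0≤+ (0≤f zero) (0≤∑ (λ i → 0≤f (suc i)))

  ∑-mono-< : ∀ {n} {f g : Vector Carrier n} → (∀ i → f i ≤ g i) → ∀ j → f j < g j → sum f < sum g
  ∑-mono-< {suc n} {f} {g} f≤g zero fj<gj = ≤-<-trans (+-monoʳ-≤ (f zero) (∑-mono-≤ (λ i → f≤g (suc i))))
    (<-respˡ-≈ (+-comm _ _) (<-respʳ-≈ (+-comm _ _) (+-monoʳ-< _ fj<gj)))
  ∑-mono-< {suc n} {f} {g} f≤g (suc j) fj<gj =
    <-≤-trans (+-monoʳ-< (f zero) (∑-mono-< (λ i → f≤g (suc i)) j fj<gj))
      (+-mono-≤ (f≤g zero) ≤-refl)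

  ∑-scale : ∀ {n} x (f : Vector Carrier n) → ∑[ i < n ] (x * f i) ≈ x * sum f
  ∑-scale x f = sym (*-distribˡ-sum x f)

  ∑-neg : ∀ {n} (f : Vector Carrier n) → ∑[ i < n ] (- f i) ≈ - sum f
  ∑-neg f = begin-equality
    sum (λ i → - f i)         ≈⟨ sum-cong-≋ (λ i → -‿as-* (f i)) ⟩
    sum (λ i → - 1# * f i)    ≈⟨ ∑-scale (- 1#) f ⟩
    - 1# * sum f              ≈⟨ -‿as-* (sum f) ⟨
    - sum f                   ∎
    where
    open ≤-Reasoning
    -‿as-* : ∀ x → - x ≈ - 1# * x
    -‿as-* = solve 1 (λ x → :- x := :- one :* x) refl

  ∑-distrib-- : ∀ {n} (f g : Vector Carrier n) → ∑[ i < n ] (f i - g i) ≈ sum f - sum g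
  ∑-distrib-- f g = trans (∑-distrib-+ f (λ i → - g i)) (+-congˡ (∑-neg g))

  ∑-const : ∀ n x → ∑[ _ < n ] x ≈ natural n * x
  ∑-const zero    x = sym (zeroˡ x)
  ∑-const (suc n) x = trans (+-congˡ (∑-const n x))
    (solve 2 (λ m x → x :+ m :* x := (one :+ m) :* x) refl (natural n) x)

  -- A pigeonhole principle that computes its index without a decidable order: comparing both sums
  -- with `f zero` plus the tail of `g`, cotransitivity tells whether the head or the tail carries a
  -- strict inequality.
  ∑-< : ∀ {n} (f g : Vector Carrier n) → sum f < sum g → ∃[ i ] f i < g i
  ∑-< {zero}  f g ∑f<∑g = ⊥-elim (irrefl refl ∑f<∑g)
  ∑-< {suc n} f g ∑f<∑g with <-cotrans ∑f<∑g (f zero + sum (λ i → g (suc i)))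
  ... | inj₁ tail< with ∑-< (λ i → f (suc i)) (λ i → g (suc i)) (+-cancelˡ-< tail<)
    where
    +-cancelˡ-< : ∀ {x y z} → z + x < z + y → x < y
    +-cancelˡ-< {x} {y} {z} z+x<z+y = <-respˡ-≈ (cancel x) (<-respʳ-≈ (cancel y) (+-monoʳ-< (- z) z+x<z+y))
      where
      cancel : ∀ w → - z + (z + w) ≈ w
      cancel = solve 2 (λ z w → :- z :+ (z :+ w) := w) refl z
  ...   | i , fi<gi = suc i , fi<gi
  ∑-< {suc n} f g ∑f<∑g | inj₂ head< = zero , 0<-⇒< (<-respʳ-≈
    (solve 3 (λ x y z → (y :+ z) :- (x :+ z) := y :- x) refl (f zero) (g zero) _)
    (<⇒0<- head<))

  term≤∑ : ∀ {n} {f : Vector Carrier n} → (∀ i → 0# ≤ f i) → ∀ j → f j ≤ sum f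
  term≤∑ {suc n} 0≤f zero    = ≤-intro (0≤∑ (λ i → 0≤f (suc i))) refl
  term≤∑ {suc n} 0≤f (suc j) = ≤-trans (term≤∑ (λ i → 0≤f (suc i)) j) (≤-intro (0≤f zero) (+-comm _ _))

  ∑-last : ∀ n (f : ℕ → Carrier) → ∑[ i < suc n ] f (toℕ i) ≈ ∑[ i < n ] f (toℕ i) + f n
  ∑-last zero    f = +-comm _ _
  ∑-last (suc n) f = trans (+-congˡ (∑-last n (λ k → f (suc k)))) (sym (+-assoc _ _ _))

  δ : ∀ {n} → Fin n → Vector Carrier n
  δ zero    zero    = 1#
  δ zero    (suc j) = 0#
  δ (suc i) zero    = 0#
  δ (suc i) (suc j) = δ i j

  δ-diag : ∀ {n} (i : Fin n) → δ i i ≡ 1#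
  δ-diag zero    = ≡.refl
  δ-diag (suc i) = δ-diag i

  δ∈01 : ∀ {n} (i j : Fin n) → i ≡ j × δ i j ≡ 1# ⊎ δ i j ≡ 0#
  δ∈01 zero    zero    = inj₁ (≡.refl , ≡.refl)
  δ∈01 zero    (suc j) = inj₂ ≡.refl
  δ∈01 (suc i) zero    = inj₂ ≡.refl
  δ∈01 (suc i) (suc j) with δ∈01 i j
  ... | inj₁ (i≡j , δ≡1) = inj₁ (≡.cong suc i≡j , δ≡1)
  ... | inj₂ δ≡0         = inj₂ δ≡0

  ∑-δ : ∀ {n} (i : Fin n) (f : Vector Carrier n) → ∑[ j < n ] (δ i j * f j) ≈ f i
  ∑-δ {suc n} zero f = begin-equality
    1# * f zero + sum (λ j → 0# * f (suc j))  ≈⟨ +-cong (*-identityˡ _) (∑-scale {n} 0# _) ⟩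
    f zero + 0# * sum (λ j → f (suc j))       ≈⟨ +-congˡ (zeroˡ _) ⟩
    f zero + 0#                               ≈⟨ +-identityʳ _ ⟩
    f zero                                    ∎
    where open ≤-Reasoning
  ∑-δ {suc n} (suc i) f = trans (+-cong (zeroˡ _) (∑-δ i (λ j → f (suc j)))) (+-identityˡ _)

  0≤δ : ∀ {n} (i j : Fin n) → 0# ≤ δ i j
  0≤δ i j with δ∈01 i j
  ... | inj₁ (_ , δ≡1) = ≤-trans 0≤1 (≤-reflexive (reflexive (≡.sym δ≡1)))
  ... | inj₂ δ≡0       = ≤-reflexive (reflexive (≡.sym δ≡0))

  -- The exact ceiling is not computable. Descending from the Archimedean bound, cotransitivity
  -- applied to x < x + 1 either allows one step further down or yields n < x + 1; hence the slack 2
  -- instead of 1.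
  ceiling : ∀ x → ∃[ n ] (x < natural n × (0# ≤ x → natural n ≤ x + (1# + 1#)))
  ceiling x with archimedean x
  ... | n , x<n = go n x<n
    where
    go : ∀ n → x < natural n → ∃[ m ] (x < natural m × (0# ≤ x → natural m ≤ x + (1# + 1#)))
    go zero x<0 = zero , x<0 , λ 0≤x → ⊥-elim (0≤x x<0)
    go (suc n) x<1+n with <-cotrans (x<x+1 x) (natural n)
      where
      x<x+1 : ∀ x → x < x + 1#
      x<x+1 x = <-respˡ-≈ (+-identityʳ x) (+-monoʳ-< x 0<1)
    ... | inj₁ x<n   = go n x<n
    ... | inj₂ n<x+1 = suc n , x<1+n , λ _ → ≤-trans (+-monoʳ-≤ 1# (<⇒≤ n<x+1))
      (≤-reflexive (solve 1 (λ x → one :+ (x :+ one) := x :+ (one :+ one)) refl x))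

-- Exponential function and logarithm

module ExpLogProperties {c ℓ₁ ℓ₂} (ℛ : RealNumbers c ℓ₁ ℓ₂) (ℰ : ExpLog ℛ) where
  open RealNumbers ℛ hiding (zero)
  open PositiveReals ℛ
  open ExpLog ℰ
  open IntegerSolver commutativeRing
  open OrderProperties ℛ

  exp-sum : ∀ {x y z} → z ≈ x + y → ↑ exp z ≈ ↑ exp x * ↑ exp y
  exp-sum z≈x+y = trans (exp-cong z≈x+y) (exp-+ _ _)

  exp-mono-< : ∀ {x y} → x < y → ↑ exp x < ↑ exp y
  exp-mono-< {x} {y} x<y = 0<-⇒< (<-respʳ-≈ eq
    (*-pos (positive (exp x)) (<-≤-trans (<⇒0<- x<y) d≤exp-d-1)))
    where
    d = y - x
    d≤exp-d-1 : d ≤ ↑ exp d - 1#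
    d≤exp-d-1 = ≤-intro (≤⇒0≤- (1+x≤exp d))
      (solve 2 (λ d e → e :- one := d :+ (e :- (one :+ d))) refl d (↑ exp d))
    eq : ↑ exp x * (↑ exp d - 1#) ≈ ↑ exp y - ↑ exp x
    eq = trans (solve 2 (λ a e → a :* (e :- one) := a :* e :- a) refl (↑ exp x) (↑ exp d))
      (+-congʳ (sym (exp-sum (solve 2 (λ x y → y := x :+ (y :- x)) refl x y))))

  exp-mono-≤ : ∀ {x y} → x ≤ y → ↑ exp x ≤ ↑ exp y
  exp-mono-≤ {x} {y} x≤y = by-cases (x < y)
    (λ x<y → <⇒≤ (exp-mono-< x<y))
    (λ y≤x → ≤-reflexive (exp-cong (≤-antisym x≤y y≤x)))

  exp-cancel-≤ : ∀ {x y} → ↑ exp x ≤ ↑ exp y → x ≤ y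
  exp-cancel-≤ ex≤ey y<x = ex≤ey (exp-mono-< y<x)

  exp-injective : ∀ {x y} → ↑ exp x ≈ ↑ exp y → x ≈ y
  exp-injective ex≈ey = ≤-antisym
    (exp-cancel-≤ (≤-reflexive ex≈ey)) (exp-cancel-≤ (≤-reflexive (sym ex≈ey)))

  exp-0 : ↑ exp 0# ≈ 1#
  exp-0 = ≤-antisym (cancel (≤-reflexive e≈e*1)) (cancel (≤-reflexive (sym e≈e*1)))
    where
    cancel : ∀ {x y} → ↑ exp 0# * x ≤ ↑ exp 0# * y → x ≤ y
    cancel = *-cancelˡ-≤ (positive (exp 0#))
    e≈e*1 : ↑ exp 0# * ↑ exp 0# ≈ ↑ exp 0# * 1#
    e≈e*1 = trans (sym (exp-sum (sym (+-identityˡ 0#)))) (sym (*-identityʳ _))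

  exp-inverse : ∀ x → ↑ exp x * ↑ exp (- x) ≈ 1#
  exp-inverse x = trans (sym (exp-sum (sym (-‿inverseʳ x)))) exp-0

  1≤exp : ∀ {x} → 0# ≤ x → 1# ≤ ↑ exp x
  1≤exp 0≤x = ≤-trans (≤-reflexive (sym exp-0)) (exp-mono-≤ 0≤x)

  exp≤1 : ∀ {x} → x ≤ 0# → ↑ exp x ≤ 1#
  exp≤1 x≤0 = ≤-trans (exp-mono-≤ x≤0) (≤-reflexive exp-0)

  log-mono-≤ : ∀ x y → ↑ x ≤ ↑ y → log x ≤ log y
  log-mono-≤ x y x≤y = exp-cancel-≤
    (≤-trans (≤-reflexive (exp-log x)) (≤-trans x≤y (≤-reflexive (sym (exp-log y)))))

  log-cancel-≤ : ∀ x y → log x ≤ log y → ↑ x ≤ ↑ y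
  log-cancel-≤ x y lx≤ly =
    ≤-trans (≤-reflexive (sym (exp-log x))) (≤-trans (exp-mono-≤ lx≤ly) (≤-reflexive (exp-log y)))

  log-exp : ∀ x → log (exp x) ≈ x
  log-exp x = exp-injective (exp-log (exp x))

  log-product : ∀ x y z → ↑ z ≈ ↑ x * ↑ y → log z ≈ log x + log y
  log-product x y z z≈xy = exp-injective (begin-equality
    ↑ exp (log z)                  ≈⟨ exp-log z ⟩
    ↑ z                            ≈⟨ z≈xy ⟩
    ↑ x * ↑ y                      ≈⟨ *-cong (exp-log x) (exp-log y) ⟨
    ↑ exp (log x) * ↑ exp (log y)  ≈⟨ exp-+ (log x) (log y) ⟨
    ↑ exp (log x + log y)          ∎)
    where open ≤-Reasoning

  log-* : ∀ x y → log (x *⁺ y) ≈ log x + log y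
  log-* x y = log-product x y (x *⁺ y) refl

  log-/ : ∀ x y → log (x /⁺ y) ≈ log x - log y
  log-/ x y = begin-equality
    log (x /⁺ y)                  ≈⟨ solve 2 (λ a b → a := a :+ b :- b) refl _ (log y) ⟩
    log (x /⁺ y) + log y - log y  ≈⟨ +-congʳ (log-product (x /⁺ y) y x (sym (/-* (↑ x) y))) ⟨
    log x - log y                 ∎
    where open ≤-Reasoning

  log≤-1 : ∀ x → log x ≤ ↑ x - 1#
  log≤-1 x = ≤-intro (≤⇒0≤- (≤-trans (1+x≤exp (log x)) (≤-reflexive (exp-log x))))
    (solve 2 (λ x l → x :- one := l :+ (x :- (one :+ l))) refl (↑ x) (log x))

  log≤ : ∀ x → log x ≤ ↑ x
  log≤ x = ≤-trans (log≤-1 x) (≤-intro 0≤1 (solve 1 (λ x → x := x :- one :+ one) refl (↑ x)))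

  0≤log : ∀ x → 1# ≤ ↑ x → 0# ≤ log x
  0≤log x 1≤x = exp-cancel-≤
    (≤-trans (≤-reflexive exp-0) (≤-trans 1≤x (≤-reflexive (sym (exp-log x)))))

  log≤0 : ∀ x → ↑ x ≤ 1# → log x ≤ 0#
  log≤0 x x≤1 = exp-cancel-≤
    (≤-trans (≤-reflexive (exp-log x)) (≤-trans x≤1 (≤-reflexive (sym exp-0))))

  -- The bound log r ≤ r - 1 at the ratio r = y / x. This form of concavity replaces derivatives in
  -- the analysis of the projection and in the mirror step.
  log-tangent : ∀ x y → log y - log x ≤ (↑ y - ↑ x) / x
  log-tangent x y = begin
    log y - log x         ≈⟨ log-/ y x ⟨
    log (y /⁺ x)          ≤⟨ log≤-1 (y /⁺ x) ⟩
    ↑ y / x - 1#          ≈⟨ +-congˡ (-‿cong (*-inverseʳ x)) ⟨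
    ↑ y / x - ↑ x / x     ≈⟨ solve 3 (λ x y r → y :* r :- x :* r := (y :- x) :* r) refl (↑ x) (↑ y) (1/ x) ⟩
    (↑ y - ↑ x) / x       ∎
    where open ≤-Reasoning

  -- Entropic projection and mirror ascent

  module _ {N} .{{_ : NonZero N}} {ε : ℝ⁺} where
    open ResourceSharing ℛ ℰ using (Δ; coord; coord⁺; sum≈1; lower; relativeEntropy; IsProjection)

    combine : ∀ {θ} → 0# ≤ θ → θ ≤ 1# → Δ ε N → Δ ε N → Δ ε N
    combine {θ} 0≤θ θ≤1 p x = record
      { coord = λ i → coord p i + θ * (coord x i - coord p i)
      ; sum≈1 = begin-equality
          sum (λ i → coord p i + θ * (coord x i - coord p i))
            ≈⟨ ∑-distrib-+ (coord p) _ ⟩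
          sum (coord p) + sum (λ i → θ * (coord x i - coord p i))
            ≈⟨ +-congˡ (trans (∑-scale {N} θ _) (*-congˡ (∑-distrib-- (coord x) (coord p)))) ⟩
          sum (coord p) + θ * (sum (coord x) - sum (coord p))
            ≈⟨ +-cong (sum≈1 p) (*-congˡ (+-cong (sum≈1 x) (-‿cong (sum≈1 p)))) ⟩
          1# + θ * (1# - 1#)
            ≈⟨ solve 1 (λ θ → one :+ θ :* (one :- one) := one) refl θ ⟩
          1# ∎
      ; lower = λ i → ≤-intro
          (0≤+ (0≤* (≤⇒0≤- θ≤1) (≤⇒0≤- (lower p i))) (0≤* 0≤θ (≤⇒0≤- (lower x i))))
          (solve 4 (λ p x e θ → p :+ θ :* (x :- p) := e :+ ((one :- θ) :* (p :- e) :+ θ :* (x :- e)))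
            refl (coord p i) (coord x i) (↑ ε / fromℕ N) θ)
      }
      where open ≤-Reasoning

    -- Only coordinate `k` can shrink, so `bound` is the only inequality to be supplied. The case
    -- `i = k` needs no separate treatment, since the two unit vectors then cancel.
    transfer : ∀ {θ} (p : Δ ε N) i k → 0# ≤ θ → ↑ ε / fromℕ N ≤ coord p k - θ → Δ ε N
    transfer {θ} p i k 0≤θ bound = record
      { coord = x
      ; sum≈1 = begin-equality
          sum x
            ≈⟨ trans (∑-distrib-+ (coord p) _) (+-congˡ (trans (∑-scale {N} θ _) (*-congˡ (∑-distrib-- (δ i) (δ k))))) ⟩
          sum (coord p) + θ * (sum (δ i) - sum (δ k))
            ≈⟨ +-cong (sum≈1 p) (*-congˡ (+-cong (sum-δ i) (-‿cong (sum-δ k)))) ⟩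
          1# + θ * (1# - 1#)
            ≈⟨ solve 1 (λ θ → one :+ θ :* (one :- one) := one) refl θ ⟩
          1# ∎
      ; lower = low
      }
      where
      open ≤-Reasoning
      x : Vector Carrier N
      x j = coord p j + θ * (δ i j - δ k j)
      sum-δ : ∀ (i : Fin N) → sum (δ i) ≈ 1#
      sum-δ i = trans (sum-cong-≋ (λ j → sym (*-identityʳ (δ i j)))) (∑-δ i (λ _ → 1#))
      low : ∀ j → ↑ ε / fromℕ N ≤ x j
      low j with δ∈01 k j
      ... | inj₁ (≡.refl , δkj≡1) = ≤-trans bound (≤-intro (0≤* 0≤θ (0≤δ i j))
        (trans (+-congˡ (*-congˡ (+-congˡ (-‿cong (reflexive δkj≡1)))))
          (solve 3 (λ p θ d → p :+ θ :* (d :- one) := p :- θ :+ θ :* d) refl (coord p j) θ (δ i j))))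
      ... | inj₂ δkj≡0 = ≤-trans (lower p j) (≤-intro (0≤* 0≤θ (0≤δ i j))
        (trans (+-congˡ (*-congˡ (+-congˡ (-‿cong (reflexive δkj≡0)))))
          (solve 3 (λ p θ d → p :+ θ :* (d :- nil) := p :+ θ :* d) refl (coord p j) θ (δ i j))))

    module Projection (y : Vector ℝ⁺ N) (p : Δ ε N) (proj : IsProjection y p) where

      -- The gradient of the relative entropy at `p`, up to the constant 1, which is invisible to
      -- directions whose coordinates sum to zero.
      slope : Vector Carrier N
      slope i = log (coord⁺ p i /⁺ y i)

      -- First-order optimality: perturbing p to p + θ (x - p) changes the
      -- entropy by at most θ ∑ (x - p) slope + θ² ∑ (x - p)² / p.
      slope-minimal : ∀ x → ∑[ i < N ] (coord p i * slope i) ≤ ∑[ i < N ] (coord x i * slope i)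
      slope-minimal x = 0≤-⇒≤ (begin
        0#      ≈⟨ -0#≈0# ⟨
        - 0#    ≤⟨ neg-mono (≤-by-scaling (0≤∑ 0≤quad) first-order) ⟩
        - - V   ≈⟨ solve 1 (λ V → :- (:- V) := V) refl V ⟩
        V       ≈⟨ ∑dv ⟩
        sum (λ i → coord x i * slope i) - sum (λ i → coord p i * slope i) ∎)
        where
        open ≤-Reasoning
        open import Algebra.Properties.Ring ring using (-0#≈0#)
        neg-mono : ∀ {x y} → x ≤ y → - y ≤ - x
        neg-mono {x} {y} x≤y = ≤-intro (≤⇒0≤- x≤y) (solve 2 (λ x y → :- x := :- y :+ (y :- x)) refl x y)
        d quad : Vector Carrier N
        d i = coord x i - coord p i
        quad i = d i * d i / coord⁺ p i
        V K : Carrier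
        V = ∑[ i < N ] (d i * slope i)
        K = ∑[ i < N ] quad i
        ∑dv : V ≈ sum (λ i → coord x i * slope i) - sum (λ i → coord p i * slope i)
        ∑dv = trans
          (sum-cong-≋ (λ i → solve 3 (λ x p v → (x :- p) :* v := x :* v :- p :* v)
               refl (coord x i) (coord p i) (slope i)))
          (∑-distrib-- (λ i → coord x i * slope i) (λ i → coord p i * slope i))
        0≤square : ∀ z → 0# ≤ z * z
        0≤square z = by-cases (0# < z)
          (λ 0<z → <⇒≤ (*-pos 0<z 0<z))
          (λ z≤0 → ≤-trans (0≤* (≤⇒0≤- z≤0) (≤⇒0≤- z≤0))
            (≤-reflexive (solve 1 (λ z → (nil :- z) :* (nil :- z) := z :* z) refl z)))
        0≤quad : ∀ i → 0# ≤ quad i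
        0≤quad i = 0≤* (0≤square (d i)) (0≤1/ (coord⁺ p i))
        first-order : ∀ θ → 0# < θ → θ < 1# → - V ≤ θ * K
        first-order θ 0<θ θ<1 = *-cancelˡ-≤ 0<θ (≤-intro (≤⇒0≤- (≤-trans (proj m) entropy-m))
          (solve 4 (λ P V θ K → θ :* (θ :* K) := θ :* :- V :+ (P :+ θ :* (V :+ nil :+ θ :* K) :- P))
            refl P V θ K))
          where
          m : Δ ε N
          m = combine (<⇒≤ 0<θ) (<⇒≤ θ<1) p x
          P : Carrier
          P = relativeEntropy (coord⁺ p) y
          ∑d : sum d ≈ 0#
          ∑d = trans (∑-distrib-- (coord x) (coord p))
            (trans (+-cong (sum≈1 x) (-‿cong (sum≈1 p))) (-‿inverseʳ 1#))
          log-ratio : ∀ i → log (coord⁺ m i /⁺ y i) ≤ slope i + θ * d i / coord⁺ p i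
          log-ratio i = begin
            log (coord⁺ m i /⁺ y i)
              ≈⟨ log-/ (coord⁺ m i) (y i) ⟩
            lm - ly
              ≈⟨ solve 3 (λ lm lp ly → lm :- ly := lp :- ly :+ (lm :- lp)) refl lm lp ly ⟩
            lp - ly + (lm - lp)
              ≤⟨ +-mono-≤ (≤-reflexive (sym (log-/ (coord⁺ p i) (y i)))) (log-tangent (coord⁺ p i) (coord⁺ m i)) ⟩
            slope i + (coord m i - coord p i) / coord⁺ p i
              ≈⟨ +-congˡ (*-congʳ (solve 2 (λ p e → p :+ e :- p := e) refl (coord p i) (θ * d i))) ⟩
            slope i + θ * d i / coord⁺ p i ∎
            where
            lm = log (coord⁺ m i)
            lp = log (coord⁺ p i)
            ly = log (y i)
          -- After the tangent bound, the cross term of p + θ d with θ d / p is θ d; it sums to zero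
          -- and leaves the `0#`. The remaining second-order part is θ² `K`.
          entropy-m : relativeEntropy (coord⁺ m) y ≤ P + θ * (V + 0# + θ * K)
          entropy-m = begin
            relativeEntropy (coord⁺ m) y
              ≤⟨ ∑-mono-≤ (λ i → *-monoˡ-≤ (0≤↑ (coord⁺ m i)) (log-ratio i)) ⟩
            sum (λ i → coord m i * (slope i + θ * d i / coord⁺ p i))
              ≈⟨ sum-cong-≋ (λ i → trans
                  (solve 5 (λ p d v θ r → (p :+ θ :* d) :* (v :+ θ :* d :* r)
                             := p :* v :+ θ :* (d :* v :+ d :* (p :* r) :+ θ :* (d :* d :* r)))
                     refl (coord p i) (d i) (slope i) θ (1/ coord⁺ p i))
                  (+-congˡ (*-congˡ (+-congʳ (+-congˡ
                    (trans (*-congˡ (*-inverseʳ (coord⁺ p i))) (*-identityʳ (d i)))))))) ⟩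
            sum (λ i → coord p i * slope i + θ * (d i * slope i + d i + θ * quad i))
              ≈⟨ trans (∑-distrib-+ (λ i → coord p i * slope i) _) (+-congˡ (trans (∑-scale {N} θ _) (*-congˡ
                   (trans (∑-distrib-+ (λ i → d i * slope i + d i) _)
                     (+-cong (∑-distrib-+ (λ i → d i * slope i) d) (∑-scale θ quad)))))) ⟩
            P + θ * (V + sum d + θ * K)
              ≈⟨ +-congˡ (*-congˡ (+-congʳ (+-congˡ ∑d))) ⟩
            P + θ * (V + 0# + θ * K) ∎

      -- If p i < σ y i, then mass can be moved to i from any k with
      -- p k > x k; so p ≤ x, strictly at i, although both sum to 1.
      scaled≤projection : ∀ σ (x : Δ ε N) → (∀ k → ↑ σ * ↑ y k ≤ coord x k) → ∀ i → ↑ σ * ↑ y i ≤ coord p i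
      scaled≤projection σ x σy≤x i pi<σyi = irrefl refl
        (<-respˡ-≈ (sum≈1 p) (<-respʳ-≈ (sum≈1 x) (∑-mono-< p≤x i (<-≤-trans pi<σyi (σy≤x i)))))
        where
        open ≤-Reasoning
        p≤x : ∀ k → coord p k ≤ coord x k
        p≤x k xk<pk = ≤-trans pk≤σyk (σy≤x k) xk<pk
          where
          -- Moving this amount lowers coordinate `k` exactly to `coord x k`, which respects the
          -- lower bound because `x` lies in the truncated simplex.
          θ = coord p k - coord x k
          0<θ : 0# < θ
          0<θ = <⇒0<- xk<pk
          z : Δ ε N
          z = transfer p i k (<⇒≤ 0<θ)
            (≤-trans (lower x k) (≤-reflexive (solve 2 (λ p x → x := p :- (p :- x))
                 refl (coord p k) (coord x k))))
          ∑z : sum (λ j → coord z j * slope j) ≈ sum (λ j → coord p j * slope j) + θ * (slope i - slope k)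
          ∑z = begin-equality
            sum (λ j → coord z j * slope j)
              ≈⟨ sum-cong-≋ (λ j → solve 5 (λ p θ a b v → (p :+ θ :* (a :- b)) :* v := p :* v :+ θ :* (a :* v :- b :* v))
                   refl (coord p j) θ (δ i j) (δ k j) (slope j)) ⟩
            sum (λ j → coord p j * slope j + θ * (δ i j * slope j - δ k j * slope j))
              ≈⟨ trans (∑-distrib-+ (λ j → coord p j * slope j) _) (+-congˡ (trans (∑-scale {N} θ _) (*-congˡ
                   (∑-distrib-- (λ j → δ i j * slope j) (λ j → δ k j * slope j))))) ⟩
            sum (λ j → coord p j * slope j) + θ * (sum (λ j → δ i j * slope j) - sum (λ j → δ k j * slope j))
              ≈⟨ +-congˡ (*-congˡ (+-cong (∑-δ i slope) (-‿cong (∑-δ k slope)))) ⟩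
            sum (λ j → coord p j * slope j) + θ * (slope i - slope k) ∎
          slope-≤ : slope k ≤ slope i
          slope-≤ = 0≤-⇒≤ (*-cancelˡ-≤ 0<θ (≤-trans (≤-reflexive (zeroʳ θ))
            (≤-trans (≤⇒0≤- (≤-trans (slope-minimal z) (≤-reflexive ∑z)))
              (≤-reflexive (solve 2 (λ P e → P :+ e :- P := e) refl _ _)))))
          pk≤σyk : coord p k ≤ ↑ σ * ↑ y k
          pk≤σyk = /≤⇒≤* (≤-trans
            (log-cancel-≤ (coord⁺ p k /⁺ y k) (coord⁺ p i /⁺ y i) slope-≤)
            (≤*⇒/≤ (<⇒≤ pi<σyi)))

    -- The last bracket telescopes over time: it is the decrease of the relative entropy of `x` with
    -- respect to the current point. Subtracting `G` rescales the unprojected point by a constant,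
    -- which only shifts `slope` by a constant; when `g ≤ G`, it makes every summand on the left
    -- nonnegative.
    mirror-step : ∀ {η G} {g : Vector Carrier N} {h p : Δ ε N} →
      IsProjection (λ i → coord⁺ h i *⁺ exp (η * g i)) p → ∀ x →
      ∑[ i < N ] (coord h i * (1# - ↑ exp (η * (g i - G)))) ≤
        η * (G - ∑[ i < N ] (coord x i * g i)) +
        (∑[ i < N ] (coord x i * log (coord⁺ p i)) - ∑[ i < N ] (coord x i * log (coord⁺ h i)))
    mirror-step {η} {G} {g} {h} {p} proj x = begin
      sum (λ i → coord h i * (1# - ↑ exp (η * (g i - G))))
        ≈⟨ trans (sum-cong-≋ (λ i → solve 2 (λ h e → h :* (one :- e) := h :- h :* e)
             refl (coord h i) (↑ exp (η * (g i - G)))))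
             (∑-distrib-- (coord h) (λ i → ↑ w i)) ⟩
      sum (coord h) - W
        ≈⟨ +-congʳ (sum≈1 h) ⟩
      1# - W
        ≈⟨ solve 3 (λ η G W → one :- W := η :* G :+ ((one :- η :* G) :* one :- W)) refl η G W ⟩
      η * G + ((1# - η * G) * 1# - W)
        ≈⟨ +-congˡ (+-congʳ (*-congˡ (sum≈1 p))) ⟨
      η * G + ((1# - η * G) * sum (coord p) - W)
        ≈⟨ +-congˡ (trans (∑-distrib-- _ (λ i → ↑ w i)) (+-congʳ (∑-scale (1# - η * G) (coord p)))) ⟨
      η * G + sum (λ i → (1# - η * G) * coord p i - ↑ w i)
        ≤⟨ +-monoʳ-≤ (η * G) (∑-mono-≤ below) ⟩
      η * G + sum (λ i → coord p i * slope i)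
        ≤⟨ +-monoʳ-≤ (η * G) (slope-minimal x) ⟩
      η * G + sum (λ i → coord x i * slope i)
        ≈⟨ +-congˡ (sum-cong-≋ (λ i → trans (*-congˡ (slope≈ i))
             (solve 5 (λ x p h η g → x :* (p :- (h :+ η :* g)) := (x :* p :- x :* h) :- η :* (x :* g))
                refl (coord x i) (lp i) (lh i) η (g i)))) ⟩
      η * G + sum (λ i → (coord x i * lp i - coord x i * lh i) - η * (coord x i * g i))
        ≈⟨ +-congˡ (trans (∑-distrib-- (λ i → coord x i * lp i - coord x i * lh i) _)
             (+-cong (∑-distrib-- (λ i → coord x i * lp i) (λ i → coord x i * lh i)) (-‿cong (∑-scale {N} η _)))) ⟩
      η * G + ((sum (λ i → coord x i * lp i) - sum (λ i → coord x i * lh i)) - η * sum (λ i → coord x i * g i))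
        ≈⟨ solve 4 (λ η G D X → η :* G :+ (D :- η :* X) := η :* (G :- X) :+ D) refl η G _ _ ⟩
      η * (G - sum (λ i → coord x i * g i)) + (sum (λ i → coord x i * lp i) - sum (λ i → coord x i * lh i)) ∎
      where
      open ≤-Reasoning
      open Projection (λ i → coord⁺ h i *⁺ exp (η * g i)) p proj
      lp lh : Vector Carrier N
      lp i = log (coord⁺ p i)
      lh i = log (coord⁺ h i)
      w : Vector ℝ⁺ N
      w i = coord⁺ h i *⁺ exp (η * (g i - G))
      W : Carrier
      W = ∑[ i < N ] (↑ w i)
      slope≈ : ∀ i → slope i ≈ lp i - (lh i + η * g i)
      slope≈ i = trans (log-/ (coord⁺ p i) _)
        (+-congˡ (-‿cong (trans (log-* (coord⁺ h i) (exp (η * g i))) (+-congˡ (log-exp _)))))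
      -- The inequality p log (p / w) ≥ p - w, from the tangent to `log` at `p i`; passing from
      -- `log (p / w)` to `slope` costs η G.
      below : ∀ i → (1# - η * G) * coord p i - ↑ w i ≤ coord p i * slope i
      below i = 0≤-⇒≤ (begin
        0#
          ≤⟨ ≤⇒0≤- (*-monoˡ-≤ (0≤↑ (coord⁺ p i)) (log-tangent (coord⁺ p i) (w i))) ⟩
        coord p i * ((↑ w i - coord p i) / coord⁺ p i) - coord p i * (log (w i) - lp i)
          ≈⟨ +-cong (trans (sym (*-assoc _ _ _)) (trans (*-congʳ (*-comm (coord p i) _)) (*-/ _ (coord⁺ p i))))
               (-‿cong (*-congˡ (+-congʳ (trans (log-* (coord⁺ h i) (exp (η * (g i - G)))) (+-congˡ (log-exp _)))))) ⟩
        (↑ w i - coord p i) - coord p i * ((lh i + η * (g i - G)) - lp i)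
          ≈⟨ solve 7 (λ w p lh lp η g G → (w :- p) :- p :* ((lh :+ η :* (g :- G)) :- lp)
                := p :* (lp :- (lh :+ η :* g)) :- ((one :- η :* G) :* p :- w))
               refl (↑ w i) (coord p i) (lh i) (lp i) η (g i) G ⟩
        coord p i * (lp i - (lh i + η * g i)) - ((1# - η * G) * coord p i - ↑ w i)
          ≈⟨ +-congʳ (*-congˡ (slope≈ i)) ⟨
        coord p i * slope i - ((1# - η * G) * coord p i - ↑ w i) ∎)

-- Queues and work

module QueueProperties {c ℓ₁ ℓ₂} (ℛ : RealNumbers c ℓ₁ ℓ₂) (ℰ : ExpLog ℛ) where
  open RealNumbers ℛ hiding (zero)
  open PositiveReals ℛ
  open IntegerSolver commutativeRing
  open OrderProperties ℛ
  open ResourceSharing ℛ ℰ using (Schedule; queue; workAt; totalWork; Feasible)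

  x≤x∨y : ∀ x y → x ≤ x ∨ y
  x≤x∨y x y = proj₁ (∨-supremum x y)

  y≤x∨y : ∀ x y → y ≤ x ∨ y
  y≤x∨y x y = proj₁ (proj₂ (∨-supremum x y))

  ∨-least : ∀ {x y z} → x ≤ z → y ≤ z → x ∨ y ≤ z
  ∨-least {x} {y} {z} = proj₂ (proj₂ (∨-supremum x y)) z

  x∧y≤x : ∀ x y → x ∧ y ≤ x
  x∧y≤x x y = proj₁ (∧-infimum x y)

  x∧y≤y : ∀ x y → x ∧ y ≤ y
  x∧y≤y x y = proj₁ (proj₂ (∧-infimum x y))

  ∧-greatest : ∀ {x y z} → z ≤ x → z ≤ y → z ≤ x ∧ y
  ∧-greatest {x} {y} {z} = proj₂ (proj₂ (∧-infimum x y)) z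

  served+left : ∀ x y → x ∧ y + (0# ∨ (y - x)) ≈ y
  -- An equation is not a negation, so the case split is made separately for each of the two
  -- inequalities.
  served+left x y = ≤-antisym
    (by-cases (y < x) (λ y<x → ≤-reflexive (scarce (<⇒≤ y<x))) (λ x≤y → ≤-reflexive (ample x≤y)))
    (by-cases (y < x) (λ y<x → ≤-reflexive (sym (scarce (<⇒≤ y<x)))) (λ x≤y → ≤-reflexive (sym (ample x≤y))))
    where
    scarce : y ≤ x → x ∧ y + (0# ∨ (y - x)) ≈ y
    scarce y≤x = trans
      (+-cong (≤-antisym (x∧y≤y x y) (∧-greatest y≤x ≤-refl))
              (≤-antisym (∨-least ≤-refl y-x≤0) (x≤x∨y 0# (y - x))))
      (+-identityʳ y)
      where
      y-x≤0 : y - x ≤ 0#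
      y-x≤0 = 0≤-⇒≤ (≤-trans (≤⇒0≤- y≤x) (≤-reflexive (solve 2 (λ x y → x :- y := nil :- (y :- x))
           refl x y)))
    ample : x ≤ y → x ∧ y + (0# ∨ (y - x)) ≈ y
    ample x≤y = trans
      (+-cong (≤-antisym (x∧y≤x x y) (∧-greatest ≤-refl x≤y))
              (≤-antisym (∨-least (≤⇒0≤- x≤y) ≤-refl) (y≤x∨y 0# (y - x))))
      (solve 2 (λ x y → x :+ (y :- x) := y) refl x y)

  module _ {N} (L h : Schedule N) where

    0≤queue : ∀ t i → 0# ≤ queue L h t i
    0≤queue zero    i = ≤-refl
    0≤queue (suc t) i = x≤x∨y 0# _

    0≤work : ∀ {t i} → 0# ≤ L t i → 0# ≤ h t i → 0# ≤ workAt L h t i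
    0≤work {t} {i} 0≤L 0≤h = ∧-greatest 0≤h (0≤+ 0≤L (0≤queue t i))

    work≤alloc : ∀ t i → workAt L h t i ≤ h t i
    work≤alloc t i = x∧y≤x _ _

    -- If the demand fell short of the allocation, the queue would be empty afterwards.
    alloc≤work : ∀ {t i} → 0# < queue L h (suc t) i → h t i ≤ workAt L h t i
    alloc≤work {t} {i} 0<Q = ∧-greatest ≤-refl (λ L+Q<h → ∨-least ≤-refl (demand≤h L+Q<h) 0<Q)
      where
      demand≤h : L t i + queue L h t i < h t i → L t i + queue L h t i - h t i ≤ 0#
      demand≤h L+Q<h = 0≤-⇒≤ (≤-trans (≤⇒0≤- (<⇒≤ L+Q<h))
        (≤-reflexive (solve 2 (λ x y → x :- y := nil :- (y :- x)) refl (h t i) _)))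

    queue-decrease : ∀ {t i} → 0# ≤ L t i → h t i ≤ 1# → queue L h t i - 1# ≤ queue L h (suc t) i
    queue-decrease {t} {i} 0≤L h≤1 = ≤-trans
      (≤-intro (0≤+ 0≤L (≤⇒0≤- h≤1))
        (solve 3 (λ l q h → l :+ q :- h := q :- one :+ (l :+ (one :- h)))
             refl (L t i) (queue L h t i) (h t i)))
      (y≤x∨y 0# _)

    totalWork-suc : ∀ t → totalWork (suc t) L h ≈ totalWork t L h + sum (workAt L h t)
    totalWork-suc t = ∑-last t (λ s → sum (workAt L h s))

    -- Conservation of load. The right-hand side does not mention `h`, which makes two schedules for
    -- the same loads comparable.
    totalWork+queue : ∀ t → totalWork t L h + sum (queue L h t) ≈ ∑[ s < t ] sum (L (toℕ s))
    totalWork+queue zero    = trans (+-identityˡ _) (sum-replicate-zero N)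
    totalWork+queue (suc t) = begin-equality
      totalWork (suc t) L h + sum (queue L h (suc t))
        ≈⟨ trans (+-congʳ (totalWork-suc t)) (+-assoc _ _ _) ⟩
      totalWork t L h + (sum (workAt L h t) + sum (queue L h (suc t)))
        ≈⟨ +-congˡ (∑-distrib-+ (workAt L h t) (queue L h (suc t))) ⟨
      totalWork t L h + sum (λ i → workAt L h t i + queue L h (suc t) i)
        ≈⟨ +-congˡ (trans (sum-cong-≋ (λ i → served+left (h t i) _)) (∑-distrib-+ (L t) (queue L h t))) ⟩
      totalWork t L h + (sum (L t) + sum (queue L h t))
        ≈⟨ solve 3 (λ w l q → w :+ (l :+ q) := w :+ q :+ l) refl _ _ _ ⟩
      totalWork t L h + sum (queue L h t) + sum (L t)
        ≈⟨ trans (+-congʳ (totalWork+queue t)) (sym (∑-last t (λ s → sum (L s)))) ⟩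
      ∑[ s < suc t ] sum (L (toℕ s)) ∎
      where open ≤-Reasoning

  module _ {N} (L h h* : Schedule N) where

    workGap : ℕ → Carrier
    workGap t = totalWork t L h* - totalWork t L h

    workGap≤queue : ∀ t → workGap t ≤ sum (queue L h t)
    workGap≤queue t = ≤-intro (0≤∑ (0≤queue L h* t)) (begin-equality
      sum (queue L h t)
        ≈⟨ solve 2 (λ w q → q := w :+ q :- w) refl (totalWork t L h) _ ⟩
      totalWork t L h + sum (queue L h t) - totalWork t L h
        ≈⟨ +-congʳ (trans (totalWork+queue L h t) (sym (totalWork+queue L h* t))) ⟩
      totalWork t L h* + sum (queue L h* t) - totalWork t L h
        ≈⟨ solve 3 (λ w* q* w → w* :+ q* :- w := w* :- w :+ q*) refl (totalWork t L h*) _ _ ⟩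
      workGap t + sum (queue L h* t) ∎)
      where open ≤-Reasoning

    workGap-suc : ∀ {t} → sum (h* t) ≤ 1# → workGap (suc t) ≤ workGap t + (1# - sum (workAt L h t))
    workGap-suc {t} Σh*≤1 = begin
      workGap (suc t)
        ≈⟨ +-cong (totalWork-suc L h* t) (-‿cong (totalWork-suc L h t)) ⟩
      (totalWork t L h* + sum (workAt L h* t)) - (totalWork t L h + sum (workAt L h t))
        ≈⟨ solve 4 (λ a b c d → (a :+ b) :- (c :+ d) := (a :- c) :+ (b :- d))
             refl (totalWork t L h*) _ _ _ ⟩
      workGap t + (sum (workAt L h* t) - sum (workAt L h t))
        ≤⟨ +-monoʳ-≤ _ (+-mono-≤ (≤-trans (∑-mono-≤ (work≤alloc L h* t)) Σh*≤1) ≤-refl) ⟩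
      workGap t + (1# - sum (workAt L h t)) ∎
      where open ≤-Reasoning

-- Regret of a run of the algorithm

module RegretBound {c ℓ₁ ℓ₂} (ℛ : RealNumbers c ℓ₁ ℓ₂) (ℰ : ExpLog ℛ) where
  open RealNumbers ℛ hiding (zero)
  open PositiveReals ℛ
  open ExpLog ℰ
  open IntegerSolver commutativeRing
  open OrderProperties ℛ
  open ExpLogProperties ℛ ℰ
  open QueueProperties ℛ ℰ
  open ResourceSharing ℛ ℰ
    using (Schedule; queue; workAt; Feasible; Δ; coord; coord⁺; sum≈1; lower; IsGain; allocation; bonus; Run)

  -- The numerator pays for the drop of a share within one round, see `share-decay`; the denominator
  -- is the least fraction of its share that an inactive user loses in the mirror step.
  wasteFactor : ∀ η → 0# < η → ℝ⁺
  wasteFactor η 0<η = exp (η + η) /⁺ (1# - ↑ exp (- η)) ,⁺ <⇒0<- (<-respʳ-≈ exp-0 (exp-mono-< -η<0))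
    where
    -η<0 : - η < 0#
    -η<0 = 0<-⇒< (<-respʳ-≈ (solve 1 (λ η → η := nil :- (:- η)) refl η) 0<η)

  module Analysis {N T} .{{_ : NonZero N}} (ε : ℝ⁺) (ε≤1 : ↑ ε ≤ 1#) (η : Carrier) (0<η : 0# < η)
    (β : Vector Carrier N) (L : Schedule N) (0≤L : ∀ t → t ℕ.< T → ∀ i → 0# ≤ L t i)
    (h : ℕ → Δ ε N) (run : Run T ε η β L h) (h* : Schedule N) (feasible : Feasible T h*) where

    open Run run

    Q w : Schedule N
    Q = queue L (allocation h)
    w = workAt L (allocation h)

    E : ℕ → Carrier
    E = workGap L (allocation h) h*

    -- `G` is the largest gain. `κ` is `η` times the gap between `G` and 1 - ε, the least gain of a
    -- comparator near an active vertex. `Λ` is log (N/ε), the range of log over the interval from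
    -- ε/N to 1 that contains all shares.
    G K κ Λ : Carrier
    G = 1# + bonus ε N
    K = ↑ wasteFactor η 0<η
    κ = η * (bonus ε N + ↑ ε)
    Λ = - log (ε /⁺ fromℕ N)

    0≤η : 0# ≤ η
    0≤η = <⇒≤ 0<η

    0≤K : 0# ≤ K
    0≤K = 0≤↑ (wasteFactor η 0<η)

    0≤coord : ∀ (x : Δ ε N) i → 0# ≤ coord x i
    0≤coord x i = 0≤↑ (coord⁺ x i)

    coord≤1 : ∀ (x : Δ ε N) i → coord x i ≤ 1#
    coord≤1 x i = ≤-trans (term≤∑ (0≤coord x) i) (≤-reflexive (sum≈1 x))

    0≤bonus : 0# ≤ bonus ε N
    0≤bonus = 0≤* (0≤* (0≤↑ ε) (0≤↑ ε)) (0≤1/ _)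

    bonus≤ε : bonus ε N ≤ ↑ ε
    bonus≤ε = ≤*⇒/≤ (*-monoˡ-≤ (0≤↑ ε) (begin
      ↑ ε                      ≤⟨ ε≤1 ⟩
      1#                       ≈⟨ *-identityˡ 1# ⟨
      1# * 1#                  ≤⟨ *-mono-≤ 0≤1 (0≤↑ (fromℕ N)) (1≤natural 8)
                                     (≤-trans (1≤natural N) (≤-reflexive (reflexive (≡.sym (↑fromℕ N))))) ⟩
      natural 8 * ↑ fromℕ N    ∎))
      where open ≤-Reasoning

    1≤G : 1# ≤ G
    1≤G = ≤-intro 0≤bonus refl

    G≤2 : G ≤ 1# + 1#
    G≤2 = +-monoʳ-≤ 1# (≤-trans bonus≤ε ε≤1)

    gain-active : ∀ {t i} → t ℕ.< T → 0# < Q t i → 1# ≤ g t i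
    gain-active {t} {i} t<T 0<Q = by-cases (coord (h t) i < β i)
      (λ h<β → ≤-trans 1≤G (≤-reflexive (sym (IsGain.gain-A¹ (gain t t<T) i (0<Q , h<β)))))
      (λ h≮β → ≤-reflexive (sym (IsGain.gain-A² (gain t t<T) i (0<Q , λ a → h≮β (proj₂ a)))))

    0≤gain : ∀ {t i} → t ℕ.< T → 0# ≤ g t i
    0≤gain {t} {i} t<T = by-cases (0# < Q t i)
      (λ 0<Q → ≤-trans 0≤1 (gain-active t<T 0<Q))
      (λ b → ≤-reflexive (sym (IsGain.gain-B (gain t t<T) i b)))

    gain≤G : ∀ {t i} → t ℕ.< T → g t i ≤ G
    gain≤G {t} {i} t<T = by-cases (0# < Q t i)
      (λ 0<Q → by-cases (coord (h t) i < β i)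
        (λ h<β → ≤-reflexive (IsGain.gain-A¹ (gain t t<T) i (0<Q , h<β)))
        (λ h≮β → ≤-trans (≤-reflexive (IsGain.gain-A² (gain t t<T) i (0<Q , λ a → h≮β (proj₂ a)))) 1≤G))
      (λ b → ≤-trans (≤-reflexive (IsGain.gain-B (gain t t<T) i b)) (≤-trans 0≤1 1≤G))

    η[g-G]≤0 : ∀ {t i} → t ℕ.< T → η * (g t i - G) ≤ 0#
    η[g-G]≤0 {t} {i} t<T = 0≤-⇒≤ (≤-trans (0≤* 0≤η (≤⇒0≤- (gain≤G t<T)))
      (≤-reflexive (solve 3 (λ η g G → η :* (G :- g) := nil :- η :* (g :- G)) refl η (g t i) G)))

    -- Put σ = exp (- η G). As gains are at most `G`, the point `h t` dominates σ `y`, and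
    -- `scaled≤projection` carries this over to the projection. As gains are nonnegative, `y` is at
    -- least `h t`; the constant then follows from `G ≤ 2`.
    share-decay : ∀ {t} → t ℕ.< T → ∀ i → coord (h t) i ≤ ↑ exp (η + η) * coord (h (suc t)) i
    share-decay {t} t<T i = begin
      coord (h t) i
        ≈⟨ trans (sym (*-identityˡ _)) (trans (*-congʳ (sym (exp-inverse (η + η)))) (*-assoc _ _ _)) ⟩
      ↑ exp (η + η) * (↑ exp (- (η + η)) * coord (h t) i)
        ≤⟨ *-monoˡ-≤ (0≤↑ (exp (η + η))) (begin
             ↑ exp (- (η + η)) * coord (h t) i
               ≤⟨ *-mono-≤ (0≤↑ (exp (- (η + η)))) (0≤↑ (y i)) (exp-mono-≤ -2η≤-ηG) h≤y ⟩
             ↑ σ * ↑ y i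
               ≤⟨ Projection.scaled≤projection y (h (suc t)) (update t t<T) σ (h t) σy≤h i ⟩
             coord (h (suc t)) i ∎) ⟩
      ↑ exp (η + η) * coord (h (suc t)) i ∎
      where
      open ≤-Reasoning
      y : Vector ℝ⁺ N
      y i = coord⁺ (h t) i *⁺ exp (η * g t i)
      σ : ℝ⁺
      σ = exp (- (η * G))
      -2η≤-ηG : - (η + η) ≤ - (η * G)
      -2η≤-ηG = ≤-intro (0≤* 0≤η (≤⇒0≤- G≤2))
        (solve 2 (λ η G → :- (η :* G) := :- (η :+ η) :+ η :* (one :+ one :- G)) refl η G)
      h≤y : coord (h t) i ≤ ↑ y i
      h≤y = ≤-trans (≤-reflexive (sym (*-identityʳ _)))
        (*-monoˡ-≤ (0≤coord (h t) i) (1≤exp (0≤* 0≤η (0≤gain t<T))))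
      σy≤h : ∀ k → ↑ σ * ↑ y k ≤ coord (h t) k
      σy≤h k = begin
        ↑ σ * (coord (h t) k * ↑ exp (η * g t k))
          ≈⟨ solve 3 (λ a b c → a :* (b :* c) := b :* (a :* c)) refl _ _ _ ⟩
        coord (h t) k * (↑ σ * ↑ exp (η * g t k))
          ≈⟨ *-congˡ (exp-sum (solve 3 (λ η g G → η :* (g :- G) := :- (η :* G) :+ η :* g)
               refl η (g t k) G)) ⟨
        coord (h t) k * ↑ exp (η * (g t k - G))
          ≤⟨ *-monoˡ-≤ (0≤coord (h t) k) (exp≤1 (η[g-G]≤0 t<T)) ⟩
        coord (h t) k * 1#
          ≈⟨ *-identityʳ _ ⟩
        coord (h t) k ∎

    lost : ℕ → Vector Carrier N
    lost t i = coord (h t) i * (1# - ↑ exp (η * (g t i - G)))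

    -- Allocation is wasted only on queues that it empties, and these users
    -- are inactive, hence without gain, in the next step.
    waste≤lost : ∀ {t} → suc t ℕ.< T → 1# - sum (w t) ≤ K * sum (lost (suc t))
    waste≤lost {t} 1+t<T = begin
      1# - sum (w t)                            ≈⟨ +-congʳ (sum≈1 (h t)) ⟨
      sum (coord (h t)) - sum (w t)             ≈⟨ ∑-distrib-- (coord (h t)) (w t) ⟨
      sum (λ i → coord (h t) i - w t i)         ≤⟨ ∑-mono-≤ termwise ⟩
      sum (λ i → K * lost (suc t) i)            ≈⟨ ∑-scale K (lost (suc t)) ⟩
      K * sum (lost (suc t))                    ∎
      where
      open ≤-Reasoning
      t<T : t ℕ.< T
      t<T = ℕ.<-trans (ℕ.n<1+n t) 1+t<T
      termwise : ∀ i → coord (h t) i - w t i ≤ K * lost (suc t) i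
      termwise i = by-cases (0# < Q (suc t) i)
        (λ 0<Q → begin
          coord (h t) i - w t i  ≤⟨ ≤-intro (≤⇒0≤- (alloc≤work L (allocation h) 0<Q))
                                     (solve 2 (λ h w → nil := h :- w :+ (w :- h))
                                          refl (coord (h t) i) (w t i)) ⟩
          0#                     ≤⟨ 0≤* 0≤K (0≤* (0≤coord (h (suc t)) i) (≤⇒0≤- (exp≤1 (η[g-G]≤0 1+t<T)))) ⟩
          K * lost (suc t) i     ∎)
        (λ inactive → begin
          coord (h t) i - w t i
            ≤⟨ ≤-intro (0≤work L (allocation h) (0≤L t t<T i) (0≤coord (h t) i))
                 (solve 2 (λ h w → h := h :- w :+ w) refl (coord (h t) i) (w t i)) ⟩
          coord (h t) i
            ≤⟨ share-decay t<T i ⟩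
          ↑ exp (η + η) * coord (h (suc t)) i
            ≈⟨ *-congʳ (/-* (↑ exp (η + η)) _) ⟨
          K * (1# - ↑ exp (- η)) * coord (h (suc t)) i
            ≈⟨ solve 3 (λ k d h → k :* d :* h := k :* (h :* d)) refl K _ _ ⟩
          K * (coord (h (suc t)) i * (1# - ↑ exp (- η)))
            ≤⟨ *-monoˡ-≤ 0≤K (*-monoˡ-≤ (0≤coord (h (suc t)) i) (≤-intro
                 (≤⇒0≤- (exp-mono-≤ (η[g-G]≤-η inactive)))
                 (solve 2 (λ a b → one :- b := one :- a :+ (a :- b)) refl _ _))) ⟩
          K * lost (suc t) i ∎)
        where
        η[g-G]≤-η : ¬ (0# < Q (suc t) i) → η * (g (suc t) i - G) ≤ - η
        η[g-G]≤-η inactive = ≤-trans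
          (≤-reflexive (*-congˡ (+-congʳ (IsGain.gain-B (gain (suc t) 1+t<T) i inactive))))
          (≤-intro (0≤* 0≤η (≤⇒0≤- 1≤G))
            (solve 2 (λ η G → :- η := η :* (nil :- G) :+ η :* (G :- one)) refl η G))

    -- A vertex of the truncated simplex: every coordinate except `j` sits at the bound ε/N. The
    -- comparator in `mirror-step` must lie in `Δ ε N`, so the unit vector itself cannot be used.
    vertex : Fin N → Δ ε N
    vertex j = record
      { coord = λ i → (1# - ↑ ε) * δ j i + ↑ ε / fromℕ N
      ; sum≈1 = begin-equality
          sum (λ i → (1# - ↑ ε) * δ j i + ↑ ε / fromℕ N)
            ≈⟨ ∑-distrib-+ (λ i → (1# - ↑ ε) * δ j i) _ ⟩
          sum (λ i → (1# - ↑ ε) * δ j i) + ∑[ _ < N ] (↑ ε / fromℕ N)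
            ≈⟨ +-cong (trans (sum-cong-≋ (λ i → *-comm (1# - ↑ ε) (δ j i))) (∑-δ j (λ _ → 1# - ↑ ε)))
                 (∑-const N (↑ ε / fromℕ N)) ⟩
          1# - ↑ ε + natural N * (↑ ε / fromℕ N)
            ≈⟨ +-congˡ (trans (*-comm _ _) (trans (*-congˡ (reflexive (≡.sym (↑fromℕ N)))) (/-* (↑ ε) (fromℕ N)))) ⟩
          1# - ↑ ε + ↑ ε
            ≈⟨ solve 1 (λ e → one :- e :+ e := one) refl (↑ ε) ⟩
          1# ∎
      ; lower = λ i → ≤-intro (0≤* (≤⇒0≤- ε≤1) (0≤δ j i)) (+-comm _ _)
      }
      where open ≤-Reasoning

    -- Up to a constant depending only on `j`, this is minus the relative entropy of `vertex j` with
    -- respect to `h t`.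
    Φ : Fin N → ℕ → Carrier
    Φ j t = ∑[ i < N ] (coord (vertex j) i * log (coord⁺ (h t) i))

    Φ≤0 : ∀ j t → Φ j t ≤ 0#
    Φ≤0 j t = ≤-trans
      (∑-mono-≤ (λ i → ≤-trans
        (*-monoˡ-≤ (0≤coord (vertex j) i) (log≤0 (coord⁺ (h t) i) (coord≤1 (h t) i)))
        (≤-reflexive (zeroʳ _))))
      (≤-reflexive (sum-replicate-zero N))

    -Λ≤Φ : ∀ j t → - Λ ≤ Φ j t
    -Λ≤Φ j t = begin
      - Λ
        ≈⟨ trans (sym (*-identityʳ _)) (*-congˡ (sym (sum≈1 (vertex j)))) ⟩
      - Λ * sum (coord (vertex j))
        ≈⟨ ∑-scale (- Λ) (coord (vertex j)) ⟨
      sum (λ i → - Λ * coord (vertex j) i)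
        ≤⟨ ∑-mono-≤ (λ i → ≤-trans (≤-reflexive (*-comm _ _)) (*-monoˡ-≤ (0≤coord (vertex j) i)
             (≤-trans (≤-reflexive (solve 1 (λ l → :- (:- l) := l) refl _))
               (log-mono-≤ (ε /⁺ fromℕ N) (coord⁺ (h t) i) (lower (h t) i))))) ⟩
      Φ j t ∎
      where open ≤-Reasoning

    ΔΦ≤Λ : ∀ j s t → Φ j t - Φ j s ≤ Λ
    ΔΦ≤Λ j s t = ≤-trans (+-mono-≤ (Φ≤0 j t) (≤-refl {x = - Φ j s}))
      (≤-intro (≤⇒0≤- (-Λ≤Φ j s)) (solve 2 (λ l p → l := nil :- p :+ (p :- :- l)) refl Λ (Φ j s)))

    0≤Λ : 0# ≤ Λ
    0≤Λ = 0≤-⇒≤ (≤-trans (≤⇒0≤- (log≤0 (ε /⁺ fromℕ N) (≤*⇒/≤ (begin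
      ↑ ε             ≤⟨ ε≤1 ⟩
      1#              ≤⟨ 1≤natural N ⟩
      natural N       ≈⟨ trans (*-identityˡ _) (reflexive (↑fromℕ N)) ⟨
      1# * ↑ fromℕ N  ∎))))
      (≤-reflexive (solve 1 (λ l → nil :- l := :- l :- nil) refl _)))
      where open ≤-Reasoning

    0≤κ : 0# ≤ κ
    0≤κ = 0≤* 0≤η (0≤+ 0≤bonus (0≤↑ ε))

    lost≤ : ∀ {t j} → t ℕ.< T → 0# < Q t j → sum (lost t) ≤ κ + (Φ j (suc t) - Φ j t)
    lost≤ {t} {j} t<T 0<Q = ≤-trans
      (mirror-step {G = G} {g = g t} {h = h t} {p = h (suc t)} (update t t<T) (vertex j))
      (+-mono-≤ (*-monoˡ-≤ 0≤η (≤-intro (≤⇒0≤- 1-ε≤gain)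
        (solve 3 (λ b e X → b :+ e := one :+ b :- X :+ (X :- (one :- e)))
             refl (bonus ε N) (↑ ε) _))) ≤-refl)
      where
      open ≤-Reasoning
      x = coord (vertex j)
      1-ε≤gain : 1# - ↑ ε ≤ ∑[ i < N ] (x i * g t i)
      1-ε≤gain = begin
        1# - ↑ ε          ≤⟨ ≤-intro (0≤↑ (ε /⁺ fromℕ N)) (+-congʳ (trans (*-congˡ (reflexive (δ-diag j))) (*-identityʳ _))) ⟩
        x j               ≈⟨ *-identityʳ _ ⟨
        x j * 1#          ≤⟨ *-monoˡ-≤ (0≤coord (vertex j) j) (gain-active t<T 0<Q) ⟩
        x j * g t j       ≤⟨ term≤∑ (λ i → 0≤* (0≤coord (vertex j) i) (0≤gain t<T)) j ⟩
        sum (λ i → x i * g t i) ∎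

    -- The waste of round `t` is charged to the mirror step of round `suc t`. Hence the activity of
    -- `j` and the change of `Φ` are taken one round later, and round `suc t` must still belong to
    -- the run.
    E-step : ∀ {t j} → suc t ℕ.< T → 0# < Q (suc t) j →
      E (suc t) ≤ E t + K * (κ + (Φ j (suc (suc t)) - Φ j (suc t)))
    E-step {t} {j} 1+t<T 0<Q = begin
      E (suc t)
        ≤⟨ workGap-suc L (allocation h) h* (Feasible.capacity feasible t (ℕ.<-trans (ℕ.n<1+n t) 1+t<T)) ⟩
      E t + (1# - sum (w t))
        ≤⟨ +-monoʳ-≤ (E t) (≤-trans (waste≤lost 1+t<T) (*-monoˡ-≤ 0≤K (lost≤ 1+t<T 0<Q))) ⟩
      E t + K * (κ + (Φ j (suc (suc t)) - Φ j (suc t))) ∎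
      where open ≤-Reasoning

    E-while-active : ∀ j v m → m ℕ.+ v ℕ.< T → (∀ k → k ℕ.< m → 0# < Q (suc (k ℕ.+ v)) j) →
      E (m ℕ.+ v) ≤ E v + (natural m * (K * κ) + K * (Φ j (suc (m ℕ.+ v)) - Φ j (suc v)))
    E-while-active j v zero    v<T active = ≤-reflexive
      (solve 4 (λ e K κ p → e := e :+ (nil :* (K :* κ) :+ K :* (p :- p))) refl (E v) K κ (Φ j (suc v)))
    E-while-active j v (suc m) 1+m+v<T active = begin
      E (suc m ℕ.+ v)
        ≤⟨ E-step 1+m+v<T (active m (ℕ.n<1+n m)) ⟩
      E (m ℕ.+ v) + K * (κ + (Φ j (suc (suc (m ℕ.+ v))) - Φ j (suc (m ℕ.+ v))))
        ≤⟨ +-mono-≤ (E-while-active j v m (ℕ.<-trans (ℕ.n<1+n _) 1+m+v<T)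
                       (λ k k<m → active k (ℕ.m<n⇒m<1+n k<m))) ≤-refl ⟩
      E v + (natural m * (K * κ) + K * (Φ j (suc (m ℕ.+ v)) - Φ j (suc v)))
          + K * (κ + (Φ j (suc (suc (m ℕ.+ v))) - Φ j (suc (m ℕ.+ v))))
        ≈⟨ solve 7 (λ e m K κ p q r → e :+ (m :* (K :* κ) :+ K :* (q :- p)) :+ K :* (κ :+ (r :- q))
                      := e :+ ((one :+ m) :* (K :* κ) :+ K :* (r :- p)))
             refl (E v) (natural m) K κ (Φ j (suc v)) (Φ j (suc (m ℕ.+ v))) (Φ j (suc (suc (m ℕ.+ v)))) ⟩
      E v + (natural (suc m) * (K * κ) + K * (Φ j (suc (suc m ℕ.+ v)) - Φ j (suc v))) ∎
      where open ≤-Reasoning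

    queue-decay : ∀ j v k → k ℕ.+ v ℕ.< T → Q (suc v) j - natural k ≤ Q (suc (k ℕ.+ v)) j
    queue-decay j v zero    _       = ≤-reflexive (x-0≈x _)
    queue-decay j v (suc k) 1+k+v<T = begin
      Q (suc v) j - (1# + natural k)
        ≈⟨ solve 2 (λ q k → q :- (one :+ k) := q :- k :- one) refl (Q (suc v) j) (natural k) ⟩
      Q (suc v) j - natural k - 1#
        ≤⟨ +-mono-≤ (queue-decay j v k (ℕ.<-trans (ℕ.n<1+n _) 1+k+v<T)) ≤-refl ⟩
      Q (suc (k ℕ.+ v)) j - 1#
        ≤⟨ queue-decrease L (allocation h) (0≤L _ 1+k+v<T j) (coord≤1 (h _) j) ⟩
      Q (suc (suc k ℕ.+ v)) j ∎
      where open ≤-Reasoning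

    -- Blocks with a fixed comparator

    module Blocks (M : ℕ) .{{_ : NonZero M}} (ρ : Carrier) (0≤ρ : 0# ≤ ρ) (KΛ≤Mρ : K * Λ ≤ natural M * ρ) where

      Crowded : ℕ → Set ℓ₂
      Crowded t = natural N * natural M < sum (Q t)

      block : ∀ v m → m ℕ.≤ M → m ℕ.+ v ℕ.< T → Crowded (suc v) →
        E (m ℕ.+ v) ≤ E v + (natural m * (K * κ) + K * Λ)
      block v m m≤M m+v<T crowded = ≤-trans
        (E-while-active j v m m+v<T active)
        (+-monoʳ-≤ (E v) (+-monoʳ-≤ _ (*-monoˡ-≤ 0≤K (ΔΦ≤Λ j _ _))))
        where
        long-queue : ∃[ j ] natural M < Q (suc v) j
        long-queue = ∑-< (λ _ → natural M) (Q (suc v)) (<-respˡ-≈ (sym (∑-const N (natural M))) crowded)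
        j = proj₁ long-queue
        active : ∀ k → k ℕ.< m → 0# < Q (suc (k ℕ.+ v)) j
        active k k<m = <-≤-trans
          (<⇒0<- (≤-<-trans (natural-mono-≤ (ℕ.≤-trans (ℕ.<⇒≤ k<m) m≤M)) (proj₂ long-queue)))
          (queue-decay j v k (ℕ.<-trans (ℕ.+-monoˡ-< v k<m) m+v<T))

      -- `ρ` spreads the price `K * Λ` of one comparator over the `M` steps of a full block, so `σ`
      -- is the amortised cost of a step.
      σ : Carrier
      σ = K * κ + ρ

      0≤σ : 0# ≤ σ
      0≤σ = 0≤+ (0≤* 0≤K 0≤κ) 0≤ρ

      -- Full blocks of length `M` are cut off at the start and pay for their comparators through
      -- `ρ`; only the final, possibly shorter block leaves an unamortised `K * Λ`. The `fuel` makes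
      -- the recursion structural, because `n ∸ M` is not a subterm of `n`.
      blocks : ∀ fuel n v → n ℕ.≤ fuel → n ℕ.+ v ℕ.< T → (∀ k → k ℕ.< n → Crowded (suc (k ℕ.+ v))) →
        E (n ℕ.+ v) ≤ E v + (natural n * σ + K * Λ)
      blocks _ zero v _ _ _ = ≤-intro (0≤* 0≤K 0≤Λ)
        (solve 3 (λ e σ l → e :+ (nil :* σ :+ l) := e :+ l) refl (E v) σ (K * Λ))
      blocks (suc fuel) n@(suc _) v n≤fuel n+v<T crowded = Sum.[ one-block , more-blocks ]′ (ℕ.≤-<-connex n M)
        where
        one-block : n ℕ.≤ M → E (n ℕ.+ v) ≤ E v + (natural n * σ + K * Λ)
        one-block n≤M = ≤-trans (block v n n≤M n+v<T (crowded 0 (ℕ.s≤s ℕ.z≤n)))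
          (≤-intro (0≤* (0≤natural n) 0≤ρ)
            (solve 5 (λ e n k r l → e :+ (n :* (k :+ r) :+ l) := e :+ (n :* k :+ l) :+ n :* r)
                 refl (E v) (natural n) (K * κ) ρ (K * Λ)))
        more-blocks : M ℕ.< n → E (n ℕ.+ v) ≤ E v + (natural n * σ + K * Λ)
        more-blocks M<n = begin
          E (n ℕ.+ v)
            ≡⟨ ≡.cong E n+v≡ ⟨
          E (n′ ℕ.+ (M ℕ.+ v))
            ≤⟨ blocks fuel n′ (M ℕ.+ v) (ℕ.≤-pred (ℕ.≤-trans n′<n n≤fuel))
                 (≡.subst (ℕ._< T) (≡.sym n+v≡) n+v<T) crowded′ ⟩
          E (M ℕ.+ v) + (natural n′ * σ + K * Λ)
            ≤⟨ +-mono-≤ (block v M ℕ.≤-refl (ℕ.≤-<-trans (ℕ.+-monoˡ-≤ v (ℕ.<⇒≤ M<n)) n+v<T)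
                           (crowded 0 (ℕ.s≤s ℕ.z≤n))) ≤-refl ⟩
          E v + (natural M * (K * κ) + K * Λ) + (natural n′ * σ + K * Λ)
            ≤⟨ +-mono-≤ (+-monoʳ-≤ (E v) (+-monoʳ-≤ _ KΛ≤Mρ)) ≤-refl ⟩
          E v + (natural M * (K * κ) + natural M * ρ) + (natural n′ * σ + K * Λ)
            ≈⟨ solve 6 (λ e m k r n l → e :+ (m :* k :+ m :* r) :+ (n :* (k :+ r) :+ l) := e :+ ((n :+ m) :* (k :+ r) :+ l))
                 refl (E v) (natural M) (K * κ) ρ (natural n′) (K * Λ) ⟩
          E v + ((natural n′ + natural M) * σ + K * Λ)
            ≈⟨ +-congˡ (+-congʳ (*-congʳ (trans (sym (natural-+ n′ M)) (reflexive (≡.cong natural n′+M≡n))))) ⟩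
          E v + (natural n * σ + K * Λ) ∎
          where
          open ≤-Reasoning
          n′ : ℕ
          n′ = n ℕ.∸ M
          n′+M≡n : n′ ℕ.+ M ≡ n
          n′+M≡n = ℕ.m∸n+n≡m (ℕ.<⇒≤ M<n)
          n′<n : n′ ℕ.< n
          n′<n = ℕ.∸-monoʳ-< (ℕ.>-nonZero⁻¹ M) (ℕ.<⇒≤ M<n)
          +M+v : ∀ k → k ℕ.+ (M ℕ.+ v) ≡ k ℕ.+ M ℕ.+ v
          +M+v k = ≡.sym (ℕ.+-assoc k M v)
          n+v≡ : n′ ℕ.+ (M ℕ.+ v) ≡ n ℕ.+ v
          n+v≡ = ≡.trans (+M+v n′) (≡.cong (ℕ._+ v) n′+M≡n)
          crowded′ : ∀ k → k ℕ.< n′ → Crowded (suc (k ℕ.+ (M ℕ.+ v)))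
          crowded′ k k<n′ = ≡.subst (λ s → Crowded (suc s)) (≡.sym (+M+v k))
            (crowded (k ℕ.+ M) (≡.subst (k ℕ.+ M ℕ.<_) n′+M≡n (ℕ.+-monoˡ-< M k<n′)))

      UncrowdedBefore : ℕ → Set ℓ₂
      UncrowdedBefore t = ∃[ n ] ∃[ v ] n ℕ.+ v ≡ t ×
        sum (Q v) ≤ natural N * natural M + 1# × (∀ k → k ℕ.< n → Crowded (suc (k ℕ.+ v)))

      -- Whether a time is crowded cannot be decided. Cotransitivity of N M < N M + 1 decides a
      -- weakened alternative, and this is where the extra 1 in the threshold comes from.
      last-uncrowded : ∀ t → UncrowdedBefore t
      last-uncrowded zero = 0 , 0 , ≡.refl ,
        ≤-trans (≤-reflexive (sum-replicate-zero N)) (0≤+ (0≤* (0≤natural N) (0≤natural M)) 0≤1) ,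
        (λ _ ())
      last-uncrowded (suc t) = Sum.[ extend (last-uncrowded t) , restart ]′
        (<-cotrans (0<-⇒< {natural N * natural M} (<-respʳ-≈ (solve 1 (λ x → one := x :+ one :- x)
             refl _) 0<1))
          (sum (Q (suc t))))
        where
        restart : sum (Q (suc t)) < natural N * natural M + 1# → UncrowdedBefore (suc t)
        restart uncrowded = 0 , suc t , ≡.refl , <⇒≤ uncrowded , (λ _ ())
        extend : UncrowdedBefore t → Crowded (suc t) → UncrowdedBefore (suc t)
        extend (n , v , ≡.refl , uncrowded , crowded-since) crowded =
          suc n , v , ≡.refl , uncrowded , crowded-until
          where
          crowded-until : ∀ k → k ℕ.< suc n → Crowded (suc (k ℕ.+ v))
          crowded-until k k<1+n = Sum.[ crowded-since k , (λ where ≡.refl → crowded) ]′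
            (ℕ.m≤n⇒m<n∨m≡n (ℕ.≤-pred k<1+n))

      -- Of the summand 2, one unit is the slack in the threshold of `last-uncrowded`. The other
      -- bounds the waste of the last round, which has no successor to which `E-step` could charge
      -- it.
      regret : .{{_ : NonZero T}} →
        E T ≤ natural N * natural M + (1# + 1#) + (natural T * σ + K * Λ)
      -- `T` is a parameter on which the run depends, so the split into zero and successor is made
      -- on a copy that is tied to it by an equation.
      regret = go T ≡.refl
        where
        open ≤-Reasoning
        from : ∀ t → suc t ≡ T → UncrowdedBefore t →
          E (suc t) ≤ natural N * natural M + (1# + 1#) + (natural (suc t) * σ + K * Λ)
        from _ ≡.refl (n , v , ≡.refl , uncrowded , crowded) = begin
          E (suc (n ℕ.+ v))
            ≤⟨ workGap-suc L (allocation h) h* (Feasible.capacity feasible (n ℕ.+ v) (ℕ.n<1+n _)) ⟩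
          E (n ℕ.+ v) + (1# - sum (w (n ℕ.+ v)))
            ≤⟨ +-mono-≤ (blocks n n v ℕ.≤-refl (ℕ.n<1+n _) crowded)
                 (≤-intro (0≤∑ (λ i → 0≤work L (allocation h) (0≤L (n ℕ.+ v) (ℕ.n<1+n _) i) (0≤coord (h (n ℕ.+ v)) i)))
                   (solve 1 (λ x → one := one :- x :+ x) refl (sum (w (n ℕ.+ v))))) ⟩
          E v + (natural n * σ + K * Λ) + 1#
            ≤⟨ +-mono-≤ (+-mono-≤ (≤-trans (workGap≤queue L (allocation h) h* v) uncrowded)
                 (+-mono-≤ (*-monoʳ-≤ 0≤σ (natural-mono-≤ (ℕ.≤-trans (ℕ.m≤m+n n v) (ℕ.n≤1+n _)))) ≤-refl)) ≤-refl ⟩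
          natural N * natural M + 1# + (natural (suc (n ℕ.+ v)) * σ + K * Λ) + 1#
            ≈⟨ solve 2 (λ x y → x :+ one :+ y :+ one := x :+ (one :+ one) :+ y) refl
                 (natural N * natural M) (natural (suc (n ℕ.+ v)) * σ + K * Λ) ⟩
          natural N * natural M + (1# + 1#) + (natural (suc (n ℕ.+ v)) * σ + K * Λ) ∎
        go : ∀ t .{{_ : NonZero t}} → t ≡ T → E t ≤ natural N * natural M + (1# + 1#) + (natural t * σ + K * Λ)
        go (suc t) 1+t≡T = from t 1+t≡T (last-uncrowded t)

-- Choice of the block length and the resulting rate

module Asymptotics {c ℓ₁ ℓ₂} (ℛ : RealNumbers c ℓ₁ ℓ₂) (ℰ : ExpLog ℛ) where
  open RealNumbers ℛ hiding (zero)
  open PositiveReals ℛ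
  open ExpLog ℰ
  open IntegerSolver commutativeRing
  open OrderProperties ℛ
  open ExpLogProperties ℛ ℰ
  open QueueProperties ℛ ℰ using (workGap)
  open RegretBound ℛ ℰ
  open ResourceSharing ℛ ℰ using (Schedule; Feasible; Δ; allocation; Run)

  ½ ⅓ ¼ ¾ : Carrier
  ½ = 1# / fromℕ 2
  ⅓ = 1# / fromℕ 3
  ¼ = 1# / fromℕ 4
  ¾ = natural 3 / fromℕ 4

  ^-+ : ∀ x {p q r} → r ≈ p + q → ↑ (x ^ r) ≈ ↑ (x ^ p) * ↑ (x ^ q)
  ^-+ x {p} {q} {r} r≈p+q = exp-sum (trans (*-congʳ r≈p+q) (distribʳ (log x) p q))

  ^-1 : ∀ x {p} → p ≈ 1# → ↑ (x ^ p) ≈ ↑ x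
  ^-1 x p≈1 = trans (exp-cong (trans (*-congʳ p≈1) (*-identityˡ _))) (exp-log x)

  ½≈¼+¼ : ½ ≈ ¼ + ¼
  ½≈¼+¼ = begin-equality
    1# * r                  ≈⟨ *-congʳ (*-inverseʳ (fromℕ 4)) ⟨
    -- The solver has to be given `natural n` as it unfolds, with a trailing `0#`; hence the
    -- spelled-out numerals.
    natural 4 * s * r       ≈⟨ solve 2 (λ r s → (one :+ (one :+ (one :+ (one :+ nil)))) :* s :* r
                                 := (one :+ (one :+ nil)) :* r :* (one :* s :+ one :* s)) refl r s ⟩
    natural 2 * r * (¼ + ¼) ≈⟨ *-congʳ (*-inverseʳ (fromℕ 2)) ⟩
    1# * (¼ + ¼)            ≈⟨ *-identityˡ _ ⟩
    ¼ + ¼                   ∎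
    where
    open ≤-Reasoning
    r = 1/ fromℕ 2
    s = 1/ fromℕ 4

  ¾≈½+¼ : ¾ ≈ ½ + ¼
  ¾≈½+¼ = trans (solve 1 (λ s → (one :+ (one :+ (one :+ nil))) :* s := one :* s :+ one :* s :+ one :* s)
       refl (1/ fromℕ 4))
    (+-congʳ (sym ½≈¼+¼))

  module _ (η a b : Carrier) (0<η : 0# < η) (0<a : 0# < a) (a≤b : a ≤ b) where

    a⁺ : ℝ⁺
    a⁺ = a ,⁺ 0<a

    -- In units of N^⅓ T^¾, the summands of `C₁` bound N M (the first two), the additive 2, T K κ, T
    -- ρ and K Λ, in this order. `γ` is the factor in Λ ≤ γ T^¼. In `C₂`, three `α` come from log N
    -- and the four units from log T.
    α K γ C₁ C₂ : Carrier
    α  = 1/ a⁺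
    K  = ↑ wasteFactor η 0<η
    γ  = α + α + α + 1#
    C₁ = 1# + (α * α + α * α) + (1# + 1#) + (K * η * (b + b) + K * γ * α + K * γ)
    C₂ = 1# + (α + α + α + (1# + 1# + (1# + 1#)))

    0≤α : 0# ≤ α
    0≤α = 0≤1/ a⁺

    0≤η : 0# ≤ η
    0≤η = <⇒≤ 0<η

    0≤K : 0# ≤ K
    0≤K = 0≤↑ (wasteFactor η 0<η)

    0≤3α : 0# ≤ α + α + α
    0≤3α = 0≤+ (0≤+ 0≤α 0≤α) 0≤α

    0≤γ : 0# ≤ γ
    0≤γ = 0≤+ 0≤3α 0≤1

    0≤C₁ : 0# ≤ C₁
    0≤C₁ = 0≤+ (0≤+ (0≤+ 0≤1 (0≤+ (0≤* 0≤α 0≤α) (0≤* 0≤α 0≤α))) (0≤+ 0≤1 0≤1))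
      (0≤+ (0≤+ (0≤* (0≤* 0≤K 0≤η) (0≤+ 0≤b 0≤b)) (0≤* (0≤* 0≤K 0≤γ) 0≤α)) (0≤* 0≤K 0≤γ))
      where
      0≤b : 0# ≤ b
      0≤b = ≤-trans (<⇒≤ 0<a) a≤b

    0≤C₂ : 0# ≤ C₂
    0≤C₂ = 0≤+ 0≤1 (0≤+ 0≤3α (0≤+ (0≤+ 0≤1 0≤1) (0≤+ 0≤1 0≤1)))

    module _ {N T} .{{_ : NonZero N}} .{{_ : NonZero T}} (ε : ℝ⁺)
      (ε-lower : (a * ↑ (fromℕ N ^ ⅓)) / (fromℕ T ^ ¼) ≤ ↑ ε)
      (ε-upper : ↑ ε ≤ (b * ↑ (fromℕ N ^ ⅓)) / (fromℕ T ^ ¼))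
      (ε≤1/10 : ↑ ε ≤ 1# / fromℕ 10) where

      ν⁺ τ⁺ : ℝ⁺
      ν⁺ = fromℕ N ^ ⅓
      τ⁺ = fromℕ T ^ ¼

      -- With N = ν³ and T = τ⁴ the fractional powers become monomials, which the ring solver can
      -- handle; `B` is the target rate.
      ν τ τ³ B logNT : Carrier
      ν = ↑ ν⁺
      τ = ↑ τ⁺
      τ³ = τ * τ * τ
      B = ν * τ³
      logNT = log (fromℕ N *⁺ fromℕ T)

      1≤↑fromℕ : ∀ n .{{_ : NonZero n}} → 1# ≤ ↑ fromℕ n
      1≤↑fromℕ n = ≤-trans (1≤natural n) (≤-reflexive (reflexive (≡.sym (↑fromℕ n))))

      1≤^ : ∀ n m .{{_ : NonZero n}} .{{_ : NonZero m}} → 1# ≤ ↑ (fromℕ n ^ (1# / fromℕ m))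
      1≤^ n m = 1≤exp (0≤* (0≤* 0≤1 (0≤1/ (fromℕ m))) (0≤log (fromℕ n) (1≤↑fromℕ n)))

      1≤ν : 1# ≤ ν
      1≤ν = 1≤^ N 3

      1≤τ : 1# ≤ τ
      1≤τ = 1≤^ T 4

      0≤ν : 0# ≤ ν
      0≤ν = 0≤↑ ν⁺

      0≤τ : 0# ≤ τ
      0≤τ = 0≤↑ τ⁺

      0≤τ³ : 0# ≤ τ³
      0≤τ³ = 0≤* (0≤* 0≤τ 0≤τ) 0≤τ

      ε≤1 : ↑ ε ≤ 1#
      ε≤1 = ≤-trans ε≤1/10 (≤*⇒/≤ (≤-trans (1≤natural 10) (≤-reflexive (sym (*-identityˡ _)))))

      N≈ν³ : ↑ fromℕ N ≈ ν * ν * ν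
      N≈ν³ = sym (begin-equality
        ν * ν * ν                               ≈⟨ *-congʳ (^-+ (fromℕ N) refl) ⟨
        ↑ (fromℕ N ^ (⅓ + ⅓)) * ν               ≈⟨ ^-+ (fromℕ N) refl ⟨
        ↑ (fromℕ N ^ (⅓ + ⅓ + ⅓))               ≈⟨ ^-1 (fromℕ N) (trans
            (solve 1 (λ r → one :* r :+ one :* r :+ one :* r := (one :+ (one :+ (one :+ nil))) :* r)
                 refl (1/ fromℕ 3))
            (*-inverseʳ (fromℕ 3))) ⟩
        ↑ fromℕ N                               ∎)
        where open ≤-Reasoning

      T^½≈τ² : ↑ (fromℕ T ^ ½) ≈ τ * τ
      T^½≈τ² = ^-+ (fromℕ T) ½≈¼+¼

      T^¾≈τ³ : ↑ (fromℕ T ^ ¾) ≈ τ³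
      T^¾≈τ³ = trans (^-+ (fromℕ T) ¾≈½+¼) (*-congʳ T^½≈τ²)

      T≈τ⁴ : ↑ fromℕ T ≈ τ³ * τ
      T≈τ⁴ = sym (begin-equality
        τ³ * τ                  ≈⟨ *-congʳ T^¾≈τ³ ⟨
        ↑ (fromℕ T ^ ¾) * τ     ≈⟨ ^-+ (fromℕ T) refl ⟨
        ↑ (fromℕ T ^ (¾ + ¼))   ≈⟨ ^-1 (fromℕ T) (trans
            (solve 1 (λ r → (one :+ (one :+ (one :+ nil))) :* r :+ one :* r := (one :+ (one :+ (one :+ (one :+ nil)))) :* r)
                 refl (1/ fromℕ 4))
            (*-inverseʳ (fromℕ 4))) ⟩
        ↑ fromℕ T               ∎)
        where open ≤-Reasoning

      logN : log (fromℕ N) ≈ log ν⁺ + log ν⁺ + log ν⁺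
      logN = trans (log-product (ν⁺ *⁺ ν⁺) ν⁺ (fromℕ N) N≈ν³) (+-congʳ (log-* ν⁺ ν⁺))

      logT : log (fromℕ T) ≈ log τ⁺ + log τ⁺ + log τ⁺ + log τ⁺
      logT = trans (log-product (τ⁺ *⁺ τ⁺ *⁺ τ⁺) τ⁺ (fromℕ T) T≈τ⁴)
        (+-congʳ (trans (log-* (τ⁺ *⁺ τ⁺) τ⁺) (+-congʳ (log-* τ⁺ τ⁺))))

      -- The lower bound on `ε` and `ε ≤ 1` are compatible only if a ν ≤ τ. This trades surplus
      -- factors ν for τ, turning ν² τ² and ν³ into multiples of at most `B`.
      ν≤ατ : ν ≤ α * τ
      ν≤ατ = begin
        ν              ≈⟨ trans (solve 3 (λ n r a → r :* (a :* n) := n :* (a :* r)) refl ν α a)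
                            (trans (*-congˡ (*-inverseʳ a⁺)) (*-identityʳ ν)) ⟨
        α * (a * ν)    ≤⟨ *-monoˡ-≤ 0≤α (/≤⇒≤* (≤-trans ε-lower ε≤1)) ⟩
        α * (1# * τ)   ≈⟨ *-congˡ (*-identityˡ τ) ⟩
        α * τ          ∎
        where open ≤-Reasoning

      1≤τ³ : 1# ≤ τ³
      1≤τ³ = ≤-trans (≤-reflexive (solve 0 (one := one :* one :* one) refl))
        (*-mono-≤ (0≤* 0≤1 0≤1) 0≤τ (*-mono-≤ 0≤1 0≤τ 1≤τ 1≤τ) 1≤τ)

      1≤B : 1# ≤ B
      1≤B = ≤-trans (≤-reflexive (sym (*-identityˡ 1#))) (*-mono-≤ 0≤1 0≤τ³ 1≤ν 1≤τ³)

      x≤x*y : ∀ {x y} → 0# ≤ x → 1# ≤ y → x ≤ x * y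
      x≤x*y 0≤x 1≤y = ≤-trans (≤-reflexive (sym (*-identityʳ _))) (*-monoˡ-≤ 0≤x 1≤y)

      τ≤B : τ ≤ B
      τ≤B = ≤-trans (x≤x*y 0≤τ (≤-trans 1≤ν (≤-trans (x≤x*y 0≤ν 1≤τ) (x≤x*y (0≤* 0≤ν 0≤τ) 1≤τ))))
        (≤-reflexive (solve 2 (λ n t → t :* (n :* t :* t) := n :* (t :* t :* t)) refl ν τ))

      Λ : Carrier
      Λ = - log (ε /⁺ fromℕ N)

      -- Writing Λ through log ν, log τ and log a, each logarithm is bounded by its argument. This
      -- crude bound is affordable: multiplied by ν² τ it still yields only ν² τ².
      Λ≤γτ : Λ ≤ γ * τ
      Λ≤γτ = begin
        - log (ε /⁺ fromℕ N)
          ≈⟨ -‿cong (log-/ ε (fromℕ N)) ⟩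
        - (log ε - log (fromℕ N))
          ≤⟨ ≤-intro (≤⇒0≤- (log-mono-≤ (a⁺ *⁺ ν⁺ /⁺ τ⁺) ε ε-lower))
               (solve 3 (λ e n x → :- (x :- n) := :- (e :- n) :+ (e :- x)) refl _ _ _) ⟩
        - (log (a⁺ *⁺ ν⁺ /⁺ τ⁺) - log (fromℕ N))
          ≈⟨ -‿cong (+-cong (trans (log-/ (a⁺ *⁺ ν⁺) τ⁺) (+-congʳ (log-* a⁺ ν⁺))) (-‿cong logN)) ⟩
        - (log a⁺ + log ν⁺ - log τ⁺ - (log ν⁺ + log ν⁺ + log ν⁺))
          ≈⟨ solve 3 (λ a n t → :- (a :+ n :- t :- (n :+ n :+ n)) := n :+ n :+ (:- a) :+ t)
               refl (log a⁺) (log ν⁺) (log τ⁺) ⟩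
        log ν⁺ + log ν⁺ + - log a⁺ + log τ⁺
          ≤⟨ +-mono-≤ (+-mono-≤ (+-mono-≤ logν≤ατ logν≤ατ) -loga≤ατ) (log≤ τ⁺) ⟩
        α * τ + α * τ + α * τ + τ
          ≈⟨ solve 2 (λ α τ → α :* τ :+ α :* τ :+ α :* τ :+ τ := (α :+ α :+ α :+ one) :* τ) refl α τ ⟩
        γ * τ ∎
        where
        open ≤-Reasoning
        logν≤ατ : log ν⁺ ≤ α * τ
        logν≤ατ = ≤-trans (log≤ ν⁺) ν≤ατ
        1⁺ α⁺ : ℝ⁺
        1⁺ = 1# ,⁺ 0<1
        α⁺ = α ,⁺ 1/-pos a⁺
        -loga≤ατ : - log a⁺ ≤ α * τ
        -loga≤ατ = begin
          -- Here - log a is log (1/a), which is at most 1/a whatever the sign of log a.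
          - log a⁺                            ≤⟨ ≤-intro (0≤log 1⁺ ≤-refl) refl ⟩
          - log a⁺ + log 1⁺                   ≈⟨ +-congˡ (log-product a⁺ α⁺ 1⁺ (sym (*-inverseʳ a⁺))) ⟩
          - log a⁺ + (log a⁺ + log α⁺)        ≈⟨ solve 2 (λ a r → :- a :+ (a :+ r) := r) refl _ _ ⟩
          log α⁺                              ≤⟨ log≤ α⁺ ⟩
          α                                   ≤⟨ x≤x*y 0≤α 1≤τ ⟩
          α * τ                               ∎

      0≤logNT : 0# ≤ logNT
      0≤logNT = 0≤log (fromℕ N *⁺ fromℕ T) (≤-trans (1≤↑fromℕ N) (x≤x*y (0≤↑ (fromℕ N)) (1≤↑fromℕ T)))

      logNT≤ : logNT ≤ (α + α + α + (1# + 1# + (1# + 1#))) * τ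
      logNT≤ = begin
        logNT
          ≈⟨ trans (log-* (fromℕ N) (fromℕ T)) (+-cong logN logT) ⟩
        log ν⁺ + log ν⁺ + log ν⁺ + (log τ⁺ + log τ⁺ + log τ⁺ + log τ⁺)
          ≤⟨ +-mono-≤ (+-mono-≤ (+-mono-≤ logν≤ατ logν≤ατ) logν≤ατ)
               (+-mono-≤ (+-mono-≤ (+-mono-≤ (log≤ τ⁺) (log≤ τ⁺)) (log≤ τ⁺)) (log≤ τ⁺)) ⟩
        α * τ + α * τ + α * τ + (τ + τ + τ + τ)
          ≈⟨ solve 2 (λ α τ → α :* τ :+ α :* τ :+ α :* τ :+ (τ :+ τ :+ τ :+ τ)
                := (α :+ α :+ α :+ (one :+ one :+ (one :+ one))) :* τ) refl α τ ⟩
        (α + α + α + (1# + 1# + (1# + 1#))) * τ ∎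
        where
        open ≤-Reasoning
        logν≤ατ : log ν⁺ ≤ α * τ
        logν≤ατ = ≤-trans (log≤ ν⁺) ν≤ατ

      rate : Carrier
      rate = ν * ↑ (fromℕ T ^ ¾) + ν * ↑ (fromℕ T ^ ½) * logNT

      rate≈ : rate ≈ B + ν * (τ * τ) * logNT
      rate≈ = +-cong (*-congˡ T^¾≈τ³) (*-congʳ (*-congˡ T^½≈τ²))

      0≤ντ² : 0# ≤ ν * (τ * τ)
      0≤ντ² = 0≤* 0≤ν (0≤* 0≤τ 0≤τ)

      B≤rate : B ≤ rate
      B≤rate = ≤-intro (0≤* 0≤ντ² 0≤logNT) rate≈

      rate≤ : rate ≤ C₂ * (ν * ↑ (fromℕ T ^ ¾))
      rate≤ = begin
        rate
          ≈⟨ rate≈ ⟩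
        B + ν * (τ * τ) * logNT
          ≤⟨ +-monoʳ-≤ B (*-monoˡ-≤ 0≤ντ² logNT≤) ⟩
        B + ν * (τ * τ) * ((α + α + α + (1# + 1# + (1# + 1#))) * τ)
          ≈⟨ solve 3 (λ n t k → n :* (t :* t :* t) :+ n :* (t :* t) :* (k :* t) := (one :+ k) :* (n :* (t :* t :* t)))
               refl ν τ (α + α + α + (1# + 1# + (1# + 1#))) ⟩
        C₂ * B
          ≈⟨ *-congˡ (*-congˡ T^¾≈τ³) ⟨
        C₂ * (ν * ↑ (fromℕ T ^ ¾)) ∎
        where open ≤-Reasoning

      module _ (β : Vector Carrier N) (L : Schedule N) (0≤L : ∀ t → t ℕ.< T → ∀ i → 0# ≤ L t i)
        (h : ℕ → Δ ε N) (run : Run T ε η β L h) (h* : Schedule N) (feasible : Feasible T h*) where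

        open Analysis ε ε≤1 η 0<η β L 0≤L h run h* feasible using (κ; bonus≤ε; 0≤Λ; module Blocks)

        -- The block length ⌈τ³/ν²⌉ balances the queue length N M against the
        -- price T Λ / M of the changes of comparator.
        blockLength : Carrier
        blockLength = τ³ * (1/ ν⁺ * 1/ ν⁺)

        0<blockLength : 0# < blockLength
        0<blockLength = *-pos (*-pos (*-pos (positive τ⁺) (positive τ⁺)) (positive τ⁺)) (*-pos (1/-pos ν⁺) (1/-pos ν⁺))

        regret≤C₁B : workGap L (allocation h) h* T ≤ C₁ * B
        regret≤C₁B = with-length (ceiling blockLength)
          where
          open ≤-Reasoning
          i j ρ : Carrier
          i = 1/ τ⁺
          j = 1/ ν⁺
          -- This is `K * Λ` divided by `blockLength`, so every `M` above `blockLength` meets the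
          -- requirement of `Blocks`.
          ρ = K * Λ * (ν * ν * (i * i * i))
          0≤KΛ : 0# ≤ K * Λ
          0≤KΛ = 0≤* 0≤K 0≤Λ
          0≤ρ : 0# ≤ ρ
          0≤ρ = 0≤* 0≤KΛ (0≤* (0≤* 0≤ν 0≤ν) (0≤* (0≤* (0≤1/ τ⁺) (0≤1/ τ⁺)) (0≤1/ τ⁺)))
          KΛ≈ : K * Λ ≈ blockLength * ρ
          KΛ≈ = sym (begin-equality
            τ³ * (j * j) * (K * Λ * (ν * ν * (i * i * i)))
              ≈⟨ solve 5 (λ t i n j l → t :* t :* t :* (j :* j) :* (l :* (n :* n :* (i :* i :* i)))
                    := l :* ((n :* j) :* (n :* j) :* ((t :* i) :* (t :* i) :* (t :* i))))
                         refl τ i ν j (K * Λ) ⟩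
            K * Λ * ((ν * j) * (ν * j) * ((τ * i) * (τ * i) * (τ * i)))
              ≈⟨ *-congˡ (*-cong (*-cong νj νj) (*-cong (*-cong τi τi) τi)) ⟩
            K * Λ * (1# * 1# * (1# * 1# * 1#))
              ≈⟨ solve 1 (λ l → l :* (one :* one :* (one :* one :* one)) := l) refl (K * Λ) ⟩
            K * Λ ∎)
            where
            νj = *-inverseʳ ν⁺
            τi = *-inverseʳ τ⁺
          natural≈ : ∀ n .{{_ : NonZero n}} → natural n ≈ ↑ fromℕ n
          natural≈ n = reflexive (≡.sym (↑fromℕ n))
          Tρ≤ : natural T * ρ ≤ K * γ * α * B
          Tρ≤ = begin
            natural T * ρ
              ≈⟨ *-congʳ (trans (natural≈ T) T≈τ⁴) ⟩
            τ³ * τ * (K * Λ * (ν * ν * (i * i * i)))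
              ≈⟨ solve 4 (λ t i n l → t :* t :* t :* t :* (l :* (n :* n :* (i :* i :* i)))
                    := n :* t :* n :* l :* ((t :* i) :* (t :* i) :* (t :* i))) refl τ i ν (K * Λ) ⟩
            ν * τ * ν * (K * Λ) * ((τ * i) * (τ * i) * (τ * i))
              ≈⟨ *-congˡ (*-cong (*-cong (*-inverseʳ τ⁺) (*-inverseʳ τ⁺)) (*-inverseʳ τ⁺)) ⟩
            ν * τ * ν * (K * Λ) * (1# * 1# * 1#)
              ≈⟨ solve 1 (λ x → x :* (one :* one :* one) := x) refl (ν * τ * ν * (K * Λ)) ⟩
            ν * τ * ν * (K * Λ)
              -- One of the two factors ν is exchanged for `α * τ`, and `Λ` for `γ * τ`.
              ≤⟨ *-mono-≤ (0≤* (0≤* 0≤ν 0≤τ) 0≤ν) (0≤* 0≤K (0≤* 0≤γ 0≤τ))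
                   (*-monoˡ-≤ (0≤* 0≤ν 0≤τ) ν≤ατ) (*-monoˡ-≤ 0≤K Λ≤γτ) ⟩
            ν * τ * (α * τ) * (K * (γ * τ))
              ≈⟨ solve 5 (λ n t a k g → n :* t :* (a :* t) :* (k :* (g :* t)) := k :* g :* a :* (n :* (t :* t :* t)))
                   refl ν τ α K γ ⟩
            K * γ * α * B ∎
          TKκ≤ : natural T * (K * κ) ≤ K * η * (b + b) * B
          TKκ≤ = begin
            natural T * (K * κ)
              ≤⟨ *-monoˡ-≤ (0≤natural T) (*-monoˡ-≤ 0≤K (*-monoˡ-≤ 0≤η (+-mono-≤ bonus≤ε ≤-refl))) ⟩
            natural T * (K * (η * (↑ ε + ↑ ε)))
              ≈⟨ *-congʳ (trans (natural≈ T) T≈τ⁴) ⟩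
            τ³ * τ * (K * (η * (↑ ε + ↑ ε)))
              ≈⟨ solve 5 (λ t3 t k h e → t3 :* t :* (k :* (h :* (e :+ e))) := k :* h :* t3 :* (e :* t :+ e :* t))
                   refl τ³ τ K η (↑ ε) ⟩
            K * η * τ³ * (↑ ε * τ + ↑ ε * τ)
              -- The upper bound on `ε` enters here, in the form ε τ ≤ b ν.
              ≤⟨ *-monoˡ-≤ (0≤* (0≤* 0≤K 0≤η) 0≤τ³) (+-mono-≤ (≤/⇒*≤ ε-upper) (≤/⇒*≤ ε-upper)) ⟩
            K * η * τ³ * (b * ν + b * ν)
              ≈⟨ solve 5 (λ t3 n k h b → k :* h :* t3 :* (b :* n :+ b :* n) := k :* h :* (b :+ b) :* (n :* t3))
                   refl τ³ ν K η b ⟩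
            K * η * (b + b) * B ∎
          KΛ≤ : K * Λ ≤ K * γ * B
          KΛ≤ = begin
            K * Λ         ≤⟨ *-monoˡ-≤ 0≤K Λ≤γτ ⟩
            K * (γ * τ)   ≈⟨ *-assoc K γ τ ⟨
            K * γ * τ     ≤⟨ *-monoˡ-≤ (0≤* 0≤K 0≤γ) τ≤B ⟩
            K * γ * B     ∎
          ν³≤ : ν * ν * ν ≤ α * α * B
          ν³≤ = begin
            ν * ν * ν
              ≤⟨ *-monoʳ-≤ 0≤ν (*-mono-≤ 0≤ν (0≤* 0≤α 0≤τ) ν≤ατ ν≤ατ) ⟩
            α * τ * (α * τ) * ν
              ≤⟨ x≤x*y (0≤* (0≤* (0≤* 0≤α 0≤τ) (0≤* 0≤α 0≤τ)) 0≤ν) 1≤τ ⟩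
            α * τ * (α * τ) * ν * τ
              ≈⟨ solve 3 (λ a t n → a :* t :* (a :* t) :* n :* t := a :* a :* (n :* (t :* t :* t)))
                   refl α τ ν ⟩
            α * α * B ∎
          NM≤ : ∀ {m} → m ≤ blockLength + (1# + 1#) → natural N * m ≤ (1# + (α * α + α * α)) * B
          NM≤ {m} m≤ = begin
            natural N * m
              ≤⟨ *-monoˡ-≤ (0≤natural N) m≤ ⟩
            natural N * (τ³ * (j * j) + (1# + 1#))
              ≈⟨ *-congʳ (trans (natural≈ N) N≈ν³) ⟩
            ν * ν * ν * (τ³ * (j * j) + (1# + 1#))
              -- Rounding the block length up by at most 2 costs 2 ν³ in N M, which `ν³≤` absorbs.
              ≈⟨ solve 3 (λ n j t3 → n :* n :* n :* (t3 :* (j :* j) :+ (one :+ one))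
                    := (n :* j) :* (n :* j) :* (n :* t3) :+ (n :* n :* n :+ n :* n :* n)) refl ν j τ³ ⟩
            (ν * j) * (ν * j) * B + (ν * ν * ν + ν * ν * ν)
              ≤⟨ +-mono-≤ (≤-reflexive (*-congʳ (*-cong (*-inverseʳ ν⁺) (*-inverseʳ ν⁺)))) (+-mono-≤ ν³≤ ν³≤) ⟩
            1# * 1# * B + (α * α * B + α * α * B)
              ≈⟨ solve 2 (λ a B → one :* one :* B :+ (a :* a :* B :+ a :* a :* B) := (one :+ (a :* a :+ a :* a)) :* B)
                   refl α B ⟩
            (1# + (α * α + α * α)) * B ∎
          with-length : ∃[ m ] (blockLength < natural m × (0# ≤ blockLength → natural m ≤ blockLength + (1# + 1#))) →
            workGap L (allocation h) h* T ≤ C₁ * B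
          with-length (zero , len<0 , _) = ⊥-elim (<-asym 0<blockLength len<0)
          with-length (M@(suc _) , len<M , M≤len+2) = begin
            workGap L (allocation h) h* T
              ≤⟨ Blocks.regret M ρ 0≤ρ (≤-trans (≤-reflexive KΛ≈) (*-monoʳ-≤ 0≤ρ (<⇒≤ len<M))) ⟩
            natural N * natural M + (1# + 1#) + (natural T * (K * κ + ρ) + K * Λ)
              ≤⟨ +-mono-≤ (+-mono-≤ (NM≤ (M≤len+2 (<⇒≤ 0<blockLength))) (+-mono-≤ 1≤B 1≤B))
                   (+-mono-≤ (≤-trans (≤-reflexive (distribˡ _ _ _)) (+-mono-≤ TKκ≤ Tρ≤)) KΛ≤) ⟩
            (1# + (α * α + α * α)) * B + (B + B) + (K * η * (b + b) * B + K * γ * α * B + K * γ * B)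
              ≈⟨ solve 5 (λ p q r s B → p :* B :+ (B :+ B) :+ (q :* B :+ r :* B :+ s :* B) := (p :+ (one :+ one) :+ (q :+ r :+ s)) :* B)
                   refl (1# + (α * α + α * α)) (K * η * (b + b)) (K * γ * α) (K * γ) B ⟩
            C₁ * B ∎

        regret≤C₁rate : workGap L (allocation h) h* T ≤ C₁ * rate
        regret≤C₁rate = ≤-trans regret≤C₁B (*-monoˡ-≤ 0≤C₁ B≤rate)

corollary1 : ∀ {c ℓ₁ ℓ₂} (ℛ : RealNumbers c ℓ₁ ℓ₂) (ℰ : ExpLog ℛ) →
  let open RealNumbers ℛ
      open PositiveReals ℛ
      open ExpLog ℰ
      open ResourceSharing ℛ ℰ
      ½ = 1# / fromℕ 2
      ⅓ = 1# / fromℕ 3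
      ¼ = 1# / fromℕ 4
      ¾ = natural 3 / fromℕ 4
  in
  (η a b : Carrier) → 0# < η → η < ⅓ → 0# < a → a ≤ b →
  ∃[ C₁ ] ∃[ C₂ ] 0# ≤ C₁ × 0# ≤ C₂ ×
    ((N T : ℕ) .{{_ : NonZero N}} .{{_ : NonZero T}} → 2 ℕ.≤ N →
     let N^⅓ = ↑ (fromℕ N ^ ⅓)
         T^_ = λ (p : Carrier) → fromℕ T ^ p
         log[NT] = log (fromℕ N *⁺ fromℕ T)
     in
     (β : Vector Carrier N) →
     (∀ i → 0# ≤ β i) →
     sum β ≤ 1# →
     (L : Schedule N) →
     (∀ t → t ℕ.< T → ∀ i → 0# ≤ L t i) →
     (ε : ℝ⁺) →
     (a * N^⅓) / (T^ ¼) ≤ ↑ ε →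
     ↑ ε ≤ (b * N^⅓) / (T^ ¼) →
     ↑ ε ≤ 1# / fromℕ 10 →
     (h : ℕ → Δ ε N) → Run T ε η β L h →
     (h* : Schedule N) → Optimal T L h* →
     (totalWork T L h* - totalWork T L (allocation h)
        ≤ C₁ * (N^⅓ * ↑ (T^ ¾) + N^⅓ * ↑ (T^ ½) * log[NT]))
     × (N^⅓ * ↑ (T^ ¾) + N^⅓ * ↑ (T^ ½) * log[NT]
        ≤ C₂ * (N^⅓ * ↑ (T^ ¾))))
corollary1 ℛ ℰ η a b 0<η _ 0<a a≤b =
  C₁ η a b 0<η 0<a a≤b , C₂ η a b 0<η 0<a a≤b ,
  0≤C₁ η a b 0<η 0<a a≤b , 0≤C₂ η a b 0<η 0<a a≤b ,
  λ N T _ β _ _ L 0≤L ε lower upper ε≤1/10 h run h* optimal →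
    regret≤C₁rate η a b 0<η 0<a a≤b ε lower upper ε≤1/10 β L 0≤L h run h* (Optimal.feasible optimal) ,
    rate≤ η a b 0<η 0<a a≤b ε lower upper ε≤1/10
  where
  open Asymptotics ℛ ℰ
  open ResourceSharing ℛ ℰ using (module Optimal)
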